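{- Let $Y$ be a walk regular graph and let $X=Y^f$ be a cyclic 2ev-cover of $Y$. Then $X$ is walk regular.
   Context: All graphs are finite, simple and undirected; the base graph $Y=(V,E)$ is connected. Covers: let $G$ be a permutation group on $R=\{1,\dots,r\}$. A symmetric arc function is a function $f:V\times V\to G\cup\{0\}$ such that $f(u,v)=0$ if and only if $\{u,v\}\notin E$, and $f(u,v)=f(v,u)^{ -1}$ whenever $f(u,v)\in G$. The cover $Y^f$ (of index $r$, or $r$-fold) is the graph with vertex set $V\times R$ in which $(v,j)$ is adjacent to $(u,k)$ exactly when $v$ is adjacent to $u$ in $Y$ and $f(u,v)j=k$. The function $f$ is normalized if $f(u,v)=\mathrm{id}$ for all edges $\{u,v\}$ of some spanning tree of $Y$. Denote by $\langle f\rangle$ the subgroup of $\mathrm{Sym}(r)$ generated by the (non-zero) values of $f$. Standing assumptions: $f$ is normalized and $\langle f\rangle$ acts regularly (i.e. simply transitively) on $\{1,\dots,r\}$. The cover is called cyclic if $\langle f\rangle$ is a cyclic group. Two-eigenvalue cover (2ev-cover): $\mathrm{Spec}(A)$ denotes the spectrum of $A$ as a multiset, and $A(\cdot)$ the adjacency matrix. One has $\mathrm{Spec}(A(Y))\subseteq\mathrm{Spec}(A(Y^f))$ as multisets, and $Y^f$ is a 2ev-cover of $Y$ if the multiset difference $\mathrm{Spec}(A(Y^f))\setminus\mathrm{Spec}(A(Y))$ has exactly two distinct elements. A graph with adjacency matrix $A$ is walk regular if $A^k$ has constant diagonal for every positive integer $k$. -}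

module Defs where

open import Level using (Level; 0ℓ; suc; _⊔_)
open import Algebra.Bundles using (CommutativeRing)
open import Algebra.Bundles.Raw using (RawSemiring; RawRing)
open import Algebra.Apartness.Bundles using (HeytingField)
import Algebra.Definitions.RawSemiring as RawSemiringDefs
open import Data.Bool.Base using (if_then_else_)
open import Data.Fin.Base using (Fin; zero; fromℕ; inject₁; punchIn)
  renaming (suc to fsuc)
import Data.Fin.Properties as Fin
open import Data.Fin.Permutation as Perm using (Permutation′; _⟨$⟩ʳ_; _∘ₚ_)
open import Data.List.Base using (List; foldr; _++_)
open import Data.List.Relation.Unary.All using (All)
import Data.List.Membership.Setoid as Membership
import Data.List.Relation.Binary.Permutation.Setoid as Permutation
open import Data.Maybe.Base using (Maybe; just; nothing)
open import Data.Nat.Base as ℕ using (ℕ)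
open import Data.Product.Base using (_×_; _,_; ∃-syntax; Σ-syntax)
open import Data.Product.Function.NonDependent.Propositional using (_×-↔_)
open import Data.Sum.Base using (_⊎_)
open import Data.Vec.Functional using (Vector)
open import Function.Bundles using (_↔_; _⇔_; Inverse)
open import Function.Construct.Composition using (_↔-∘_)
open import Function.Construct.Identity using (↔-id)
open import Function.Definitions using (Injective)
open import Relation.Binary.Construct.Closure.ReflexiveTransitive using (Star)
open import Relation.Binary.Core using (Rel)
open import Relation.Binary.Definitions using (Decidable; Symmetric; Irreflexive)
open import Relation.Binary.PropositionalEquality
  using (_≡_; refl; sym; trans; cong)
open import Relation.Binary.Structures using (IsStrictPartialOrder)
open import Relation.Nullary using (¬_; Dec; yes; no; does)
open import Relation.Nullary.Decidable using (map′; _×-dec_)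
open import Relation.Unary using (Pred; _∈_)

-- ℝ is specified axiomatically, as a Cauchy-complete Archimedean ordered
-- field.  The axioms are phrased so that constructive reals satisfy them
-- too; with excluded middle they characterise ℝ up to isomorphism.

record RealNumbers (c ℓ₁ ℓ₂ : Level) : Set (suc (c ⊔ ℓ₁ ⊔ ℓ₂)) where
  infix 4 _<_
  field
    heytingField : HeytingField c ℓ₁ ℓ₂

  open HeytingField heytingField public

  commutativeRing : CommutativeRing c ℓ₁
  commutativeRing = record { isCommutativeRing = isCommutativeRing }

  open CommutativeRing commutativeRing public using (rawRing)
  open RawRing rawRing public using (rawSemiring)
  open RawSemiringDefs rawSemiring public using () renaming (_×_ to _·_)

  field
    _<_                  : Rel Carrier ℓ₂
    isStrictPartialOrder : IsStrictPartialOrder _≈_ _<_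
    #⇔<⊎>                : ∀ x y → x # y ⇔ (x < y ⊎ y < x)
    +-monoˡ-<            : ∀ {x y} z → x < y → x + z < y + z
    *-pos                : ∀ {x y} → 0# < x → 0# < y → 0# < x * y
    archimedean          : ∀ x → ∃[ n ] x < n · 1#

  Within : Carrier → Carrier → Carrier → Set ℓ₂
  Within ε x y = (x < y + ε) × (y < x + ε)

  Cauchy : (ℕ → Carrier) → Set (c ⊔ ℓ₂)
  Cauchy s = ∀ ε → 0# < ε →
             ∃[ N ] (∀ m n → N ℕ.≤ m → N ℕ.≤ n → Within ε (s m) (s n))

  _ConvergesTo_ : (ℕ → Carrier) → Carrier → Set (c ⊔ ℓ₂)
  s ConvergesTo l = ∀ ε → 0# < ε → ∃[ N ] (∀ n → N ℕ.≤ n → Within ε (s n) l)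

  field
    complete : ∀ s → Cauchy s → ∃[ l ] s ConvergesTo l

Matrix : ∀ {a} → Set a → ℕ → Set a
Matrix A n = Fin n → Fin n → A

module MatrixPower {a ℓ} (S : RawSemiring a ℓ) where
  open RawSemiring S
  open RawSemiringDefs S using (sum)

  identity : ∀ {n} → Matrix Carrier n
  identity i j = if does (i Fin.≟ j) then 1# else 0#

  infixl 7 _⊗_
  _⊗_ : ∀ {n} → Matrix Carrier n → Matrix Carrier n → Matrix Carrier n
  (M ⊗ N) i j = sum (λ k → M i k * N k j)

  infixr 8 _^ᴹ_
  _^ᴹ_ : ∀ {n} → Matrix Carrier n → ℕ → Matrix Carrier n
  M ^ᴹ ℕ.zero  = identity
  M ^ᴹ ℕ.suc k = M ⊗ M ^ᴹ k

module Determinant {a ℓ} (R : RawRing a ℓ) where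
  open RawRing R
  open RawSemiringDefs rawSemiring using (sum)

  sign : ∀ {n} → Fin n → Carrier
  sign zero     = 1#
  sign (fsuc i) = - sign i

  -- Laplace expansion along the first row.
  det : ∀ {n} → Matrix Carrier n → Carrier
  det {ℕ.zero}  M = 1#
  det {ℕ.suc n} M =
    sum (λ j → sign j * M zero j * det (λ i k → M (fsuc i) (punchIn j k)))

module Spectrum {c ℓ₁ ℓ₂} (ℝ : RealNumbers c ℓ₁ ℓ₂) where
  open RealNumbers ℝ
  open Determinant rawRing using (det)
  open MatrixPower rawSemiring using (identity)
  open Membership setoid using () renaming (_∈_ to _∈ᴸ_)

  charPoly : ∀ {n} → Matrix Carrier n → Carrier → Carrier
  charPoly M t = det (λ i j → t * identity i j + - M i j)

  -- Multisets of reals are lists, compared up to permutation.  The list σ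
  -- is the spectrum of M when it lists the roots of the characteristic
  -- polynomial with their multiplicities, i.e. det (t I − M) = ∏ (t − λ).
  -- Over the infinite field ℝ, equality of polynomials is equality of the
  -- functions they define.
  IsSpectrum : ∀ {n} → Matrix Carrier n → List Carrier → Set (c ⊔ ℓ₁)
  IsSpectrum M σ = ∀ t → charPoly M t ≈ foldr (λ x p → (t + - x) * p) 1# σ

  ExactlyTwoDistinct : List Carrier → Set (c ⊔ ℓ₁)
  ExactlyTwoDistinct σ =
    ∃[ θ ] ∃[ τ ] (¬ θ ≈ τ) × θ ∈ᴸ σ × τ ∈ᴸ σ × All (λ x → x ≈ θ ⊎ x ≈ τ) σ

record Graph (V : Set) : Set₁ where
  field
    Adj    : Rel V 0ℓ
    adj?   : Decidable Adj
    symm   : Symmetric Adj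
    irrefl : Irreflexive _≡_ Adj

module _ {V : Set} where

  Connected : Graph V → Set
  Connected Y = ∀ u v → Star (Graph.Adj Y) u v

  -- A cycle c₀, …, cₘ has at least three vertices, hence m = 2 + k.
  HasCycle : Graph V → Set
  HasCycle Y = ∃[ k ] Σ[ c ∈ Vector V (ℕ.suc (2 ℕ.+ k)) ]
      Injective _≡_ _≡_ c
    × (∀ (i : Fin (2 ℕ.+ k)) → Adj (c (inject₁ i)) (c (fsuc i)))
    × Adj (c (fromℕ (2 ℕ.+ k))) (c zero)
    where open Graph Y

  record IsSpanningTree (Y T : Graph V) : Set where
    field
      subgraph  : ∀ {u v} → Graph.Adj T u v → Graph.Adj Y u v
      connected : Connected T
      acyclic   : ¬ HasCycle T

  adjacencyMatrix : ∀ {a ℓ n} (S : RawSemiring a ℓ) →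
                    Fin n ↔ V → Graph V → Matrix (RawSemiring.Carrier S) n
  adjacencyMatrix S enum Y i j =
    if does (Graph.adj? Y (Inverse.to enum i) (Inverse.to enum j))
    then RawSemiring.1# S else RawSemiring.0# S

  WalkRegular : ∀ {n} → Fin n ↔ V → Graph V → Set
  WalkRegular enum Y = ∀ k → 1 ℕ.≤ k → ∀ i j → (A ^ᴹ k) i i ≡ (A ^ᴹ k) j j
    where
    open MatrixPower ℕ.+-*-rawSemiring
    A = adjacencyMatrix ℕ.+-*-rawSemiring enum Y

record IsPermutationGroup {r : ℕ} (G : Pred (Permutation′ r) 0ℓ) : Set where
  field
    resp : ∀ {g h} → g Perm.≈ h → g ∈ G → h ∈ G
    id∈  : Perm.id ∈ G
    ∘∈   : ∀ {g h} → g ∈ G → h ∈ G → g ∘ₚ h ∈ G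
    inv∈ : ∀ {g} → g ∈ G → Perm.flip g ∈ G

data ⟨_⟩ {r : ℕ} (S : Pred (Permutation′ r) 0ℓ) : Pred (Permutation′ r) 0ℓ where
  gen  : ∀ {g} → g ∈ S → g ∈ ⟨ S ⟩
  resp : ∀ {g h} → g Perm.≈ h → g ∈ ⟨ S ⟩ → h ∈ ⟨ S ⟩
  id∈  : Perm.id ∈ ⟨ S ⟩
  ∘∈   : ∀ {g h} → g ∈ ⟨ S ⟩ → h ∈ ⟨ S ⟩ → g ∘ₚ h ∈ ⟨ S ⟩
  inv∈ : ∀ {g} → g ∈ ⟨ S ⟩ → Perm.flip g ∈ ⟨ S ⟩

ActsRegularly : ∀ {r} → Pred (Permutation′ r) 0ℓ → Set
ActsRegularly H = ∀ i j → ∃[ g ] g ∈ H × g ⟨$⟩ʳ i ≡ j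
                              × (∀ h → h ∈ H → h ⟨$⟩ʳ i ≡ j → h Perm.≈ g)

IsCyclic : ∀ {r} → Pred (Permutation′ r) 0ℓ → Set
IsCyclic H = ∃[ g ] (∀ h → h ∈ H ⇔ h ∈ ⟨ Perm._≈ g ⟩)

-- The adjoined element 0 of G ∪ {0} is `nothing`.
record SymmetricArcFunction {V : Set} (Y : Graph V) {r : ℕ}
                            (G : Pred (Permutation′ r) 0ℓ) : Set where
  open Graph Y
  field
    value    : V → V → Maybe (Permutation′ r)
    value∈   : ∀ {u v g} → value u v ≡ just g → g ∈ G
    zero⇔    : ∀ u v → value u v ≡ nothing ⇔ (¬ Adj u v)
    inverse  : ∀ {u v g} → value u v ≡ just g →
               ∃[ h ] value v u ≡ just h × g Perm.≈ Perm.flip h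

  Values : Pred (Permutation′ r) 0ℓ
  Values g = ∃[ u ] ∃[ v ] value u v ≡ just g

  Normalized : Set₁
  Normalized = ∃[ T ] IsSpanningTree Y T
    × (∀ u v → Graph.Adj T u v → ∃[ g ] value u v ≡ just g × g Perm.≈ Perm.id)

  CoverAdj : Rel (V × Fin r) 0ℓ
  CoverAdj (v , j) (u , k) = Adj v u × ∃[ g ] value u v ≡ just g × g ⟨$⟩ʳ j ≡ k

  fibre? : ∀ (m : Maybe (Permutation′ r)) j k →
           Dec (∃[ g ] m ≡ just g × g ⟨$⟩ʳ j ≡ k)
  fibre? nothing  j k = no λ { (_ , () , _) }
  fibre? (just g) j k = map′ (λ e → g , refl , e) (λ { (_ , refl , e) → e })
                             ((g ⟨$⟩ʳ j) Fin.≟ k)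

  coverSym : Symmetric CoverAdj
  coverSym {v , j} {u , k} (a , g , eq , gj≡k) with inverse eq
  ... | h , eq′ , g≈h⁻¹ = symm a , h , eq′ ,
    trans (cong (h ⟨$⟩ʳ_) (trans (sym gj≡k) (g≈h⁻¹ j))) (Perm.inverseʳ h)

  cover : Graph (V × Fin r)
  cover = record
    { Adj    = CoverAdj
    ; adj?   = λ { (v , j) (u , k) → adj? v u ×-dec fibre? (value u v) j k }
    ; symm   = λ {x} {y} → coverSym {x} {y}
    ; irrefl = λ { refl (a , _) → irrefl refl a }
    }

coverEnum : ∀ {V : Set} {n} → Fin n ↔ V → ∀ r → Fin (n ℕ.* r) ↔ (V × Fin r)
coverEnum enum r = (enum ×-↔ ↔-id (Fin r)) ↔-∘ Fin.*↔×

module _ {c ℓ₁ ℓ₂} (ℝ : RealNumbers c ℓ₁ ℓ₂) where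
  open RealNumbers ℝ using (Carrier; rawSemiring; setoid)
  open Spectrum ℝ
  open Permutation setoid using (_↭_)

  -- The field `split` says that δ is the multiset difference σX ∖ σY.
  record Is2evCover {V : Set} {n r : ℕ} (enum : Fin n ↔ V) (Y : Graph V)
                    {G : Pred (Permutation′ r) 0ℓ}
                    (f : SymmetricArcFunction Y G) : Set (c ⊔ ℓ₁) where
    field
      σY σX δ : List Carrier
      specY   : IsSpectrum (adjacencyMatrix rawSemiring enum Y) σY
      specX   : IsSpectrum (adjacencyMatrix rawSemiring (coverEnum enum r)
                              (SymmetricArcFunction.cover f)) σX
      split   : σX ↭ σY ++ δ
      twoEv   : ExactlyTwoDistinct δ

{-# OPTIONS --safe #-}
-- Let X, Y be the adjacency matrices of the cover and of the base, and let π be the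
-- projection. X acts as Y on vectors constant on the fibres of π, hence every
-- polynomial p (X) acts as p (Y). For p = 4 (t − θ) (t − τ), which kills the new
-- eigenvalues, p (X)² and p (Y)² have the same trace, and since p (X) and p (Y) are
-- symmetric this forces r p (X)[x,y] = p (Y)[πx,πy]: the sum of the squares of the
-- differences is r² (tr p (X)² − tr p (Y)²) = 0. Thus each power of X is, up to
-- scale, a lift of a polynomial in Y plus a combination of X and I, all of which
-- have constant diagonals.
--
-- No eigenvectors are needed. The identity tr p (M)² = ∑ p (λ)² follows from
-- det (t I − s M) = ∏ (t − s λ): this form is stable under affine changes of M, and
-- under squaring because det (t I − s M) det (t I + s M) = det (t² I − s² M²), while
-- its derivative at s = 0 (for t = 1) is minus the trace.
module Submission where

open import Defs
open import Level using (_⊔_; 0ℓ)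
open import Algebra.Bundles using (CommutativeRing)
open import Algebra.Apartness.Bundles using (HeytingField)
open import Algebra.Bundles.Raw using (RawRing)
open import Data.Bool.Base using (true; false; if_then_else_)
open import Data.Empty using (⊥; ⊥-elim)
open import Data.Fin.Base using (Fin; zero; suc; punchIn; combine; quotient; remainder; remQuot; _↑ˡ_; _↑ʳ_)
open import Data.Fin.Permutation using (Permutation′; _⟨$⟩ʳ_)
import Data.Fin.Properties as Fin
open import Data.List.Base using (List; []; _∷_; foldr; length; _++_)
open import Data.Maybe.Base using (just; nothing)
open import Data.Nat.Base as ℕ using (ℕ; zero; suc)
import Data.Nat.Properties as ℕ
open import Data.Product.Base using (_×_; _,_; ∃-syntax; proj₁; proj₂)
open import Data.Sum.Base using (_⊎_; inj₁; inj₂)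
open import Data.Vec.Base using (Vec; []; _∷_; tabulate)
open import Data.Vec.Functional using (Vector; insertAt)
open import Function.Base using (_∘_; id)
open import Function.Bundles using (_↔_; Inverse; Equivalence; mk⇔)
open import Relation.Binary.Definitions using (WeaklyDecidable; tri<; tri≈; tri>)
open import Relation.Binary.PropositionalEquality as ≡ using (_≡_; _≗_)
open import Relation.Binary.Structures using (IsStrictPartialOrder)
open import Relation.Nullary using (¬_; does; yes; no)
open import Relation.Nullary.Decidable using (does-⇔; dec-false)
open import Relation.Unary using (Pred)
open SymmetricArcFunction using (Values; Normalized; cover)

-- The factor 4 completes the square: `4 (t − θ) (t − τ) = (2 t − (θ + τ))² − (θ − τ)²`. So `p` is
-- built without denominators from affine maps and squarings alone, the operations under which the
-- spectrum can be followed. The hypothesis on spectra equates two functions of `t` and does not say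
-- that the list of eigenvalues has as many members as the matrix has rows. This has to be extracted
-- before the second variable can be introduced. Two obstacles shape the preparations. Determinants
-- are given by Laplace expansion, so their multiplicativity is derived from the uniqueness of
-- alternating multilinear forms. And equality and order on ℝ are undecidable: leading coefficients
-- cannot be tested for zero, division requires apartness from zero, and the step from a vanishing
-- sum of squares to vanishing terms goes through tightness of apartness.

-- Normalisation in commutative rings with integer coefficients

module IntegerCoefficients {c ℓ} (R : CommutativeRing c ℓ) where
  open CommutativeRing R hiding (zero)
  open import Algebra.Properties.Ring ring
    using (-‿distribˡ-*; -‿distribʳ-*; -‿involutive; -0#≈0#; -‿+-comm)
  open import Algebra.Properties.Semiring.Mult.TCOptimised semiring
    using (1+×; ×-homo-+; ×1-homo-*) renaming (_×_ to _·_)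
  open import Algebra.Solver.Ring.AlmostCommutativeRing
    using (fromCommutativeRing; Induced-equivalence; _-Raw-AlmostCommutative⟶_)
  open import Data.Integer.Base as ℤ using (ℤ; +_; -[1+_]; _⊖_)
  import Data.Integer.Properties as ℤ
  open import Relation.Binary.Reasoning.Setoid setoid

  -- With this version of `_·_`, `1 · 1#` computes to `1#`, so the solver constants `:0` and `:1`
  -- denote `0#` and `1#` on the nose.
  ⟦_⟧ℤ : ℤ → Carrier
  ⟦ + n ⟧ℤ      = n · 1#
  ⟦ -[1+ n ] ⟧ℤ = - (suc n · 1#)

  ⟦⟧-neg : ∀ i → ⟦ ℤ.- i ⟧ℤ ≈ - ⟦ i ⟧ℤ
  ⟦⟧-neg (+ zero)   = sym -0#≈0#
  ⟦⟧-neg (+ suc n)  = refl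
  ⟦⟧-neg (-[1+ n ]) = sym (-‿involutive _)

  ⟦⟧-⊖ : ∀ m n → ⟦ m ⊖ n ⟧ℤ ≈ m · 1# - n · 1#
  ⟦⟧-⊖ m       zero    = sym (trans (+-congˡ -0#≈0#) (+-identityʳ _))
  ⟦⟧-⊖ zero    (suc n) = sym (+-identityˡ _)
  ⟦⟧-⊖ (suc m) (suc n) = begin
    ⟦ suc m ⊖ suc n ⟧ℤ                    ≡⟨ ≡.cong ⟦_⟧ℤ (ℤ.[1+m]⊖[1+n]≡m⊖n m n) ⟩
    ⟦ m ⊖ n ⟧ℤ                            ≈⟨ ⟦⟧-⊖ m n ⟩
    m · 1# - n · 1#                       ≈⟨ +-congʳ (+-identityʳ _) ⟨
    m · 1# + 0# - n · 1#                  ≈⟨ +-congʳ (+-congˡ (-‿inverseʳ 1#)) ⟨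
    m · 1# + (1# - 1#) - n · 1#           ≈⟨ +-congʳ (+-assoc _ _ _) ⟨
    m · 1# + 1# - 1# - n · 1#             ≈⟨ +-assoc _ _ _ ⟩
    m · 1# + 1# + (- 1# - n · 1#)         ≈⟨ +-cong (+-comm _ _) (-‿+-comm 1# _) ⟩
    1# + m · 1# - (1# + n · 1#)           ≈⟨ +-cong (1+× m 1#) (-‿cong (1+× n 1#)) ⟨
    suc m · 1# - suc n · 1#               ∎

  ⟦⟧-+ : ∀ i j → ⟦ i ℤ.+ j ⟧ℤ ≈ ⟦ i ⟧ℤ + ⟦ j ⟧ℤ
  ⟦⟧-+ (+ m)      (+ n)      = ×-homo-+ 1# m n
  ⟦⟧-+ (+ m)      (-[1+ n ]) = ⟦⟧-⊖ m (suc n)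
  ⟦⟧-+ (-[1+ m ]) (+ n)      = trans (⟦⟧-⊖ n (suc m)) (+-comm _ _)
  ⟦⟧-+ i@(-[1+ m ]) j@(-[1+ n ]) = begin
    ⟦ i ℤ.+ j ⟧ℤ                         ≡⟨ ≡.cong ⟦_⟧ℤ (ℤ.neg-distrib-+ (+ suc m) (+ suc n)) ⟨
    ⟦ ℤ.- (+ suc m ℤ.+ + suc n) ⟧ℤ       ≈⟨ ⟦⟧-neg (+ suc m ℤ.+ + suc n) ⟩
    - ⟦ + suc m ℤ.+ + suc n ⟧ℤ           ≈⟨ -‿cong (×-homo-+ 1# (suc m) (suc n)) ⟩
    - (suc m · 1# + suc n · 1#)          ≈⟨ -‿+-comm _ _ ⟨
    ⟦ i ⟧ℤ + ⟦ j ⟧ℤ                      ∎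

  ⟦⟧-*-pos : ∀ m j → ⟦ + m ℤ.* j ⟧ℤ ≈ ⟦ + m ⟧ℤ * ⟦ j ⟧ℤ
  ⟦⟧-*-pos m (+ n)      = trans (reflexive (≡.cong ⟦_⟧ℤ (≡.sym (ℤ.pos-* m n)))) (×1-homo-* m n)
  ⟦⟧-*-pos m (-[1+ n ]) = begin
    ⟦ + m ℤ.* -[1+ n ] ⟧ℤ        ≡⟨ ≡.cong ⟦_⟧ℤ (ℤ.neg-distribʳ-* (+ m) (+ suc n)) ⟨
    ⟦ ℤ.- (+ m ℤ.* + suc n) ⟧ℤ   ≈⟨ ⟦⟧-neg (+ m ℤ.* + suc n) ⟩
    - ⟦ + m ℤ.* + suc n ⟧ℤ       ≈⟨ -‿cong (⟦⟧-*-pos m (+ suc n)) ⟩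
    - (m · 1# * (suc n · 1#))    ≈⟨ -‿distribʳ-* _ _ ⟩
    m · 1# * - (suc n · 1#)      ∎

  ⟦⟧-* : ∀ i j → ⟦ i ℤ.* j ⟧ℤ ≈ ⟦ i ⟧ℤ * ⟦ j ⟧ℤ
  ⟦⟧-* (+ m)      j = ⟦⟧-*-pos m j
  ⟦⟧-* (-[1+ m ]) j = begin
    ⟦ -[1+ m ] ℤ.* j ⟧ℤ          ≡⟨ ≡.cong ⟦_⟧ℤ (ℤ.neg-distribˡ-* (+ suc m) j) ⟨
    ⟦ ℤ.- (+ suc m ℤ.* j) ⟧ℤ     ≈⟨ ⟦⟧-neg (+ suc m ℤ.* j) ⟩
    - ⟦ + suc m ℤ.* j ⟧ℤ         ≈⟨ -‿cong (⟦⟧-*-pos (suc m) j) ⟩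
    - (suc m · 1# * ⟦ j ⟧ℤ)      ≈⟨ -‿distribˡ-* _ _ ⟩
    - (suc m · 1#) * ⟦ j ⟧ℤ      ∎

  morphism : ℤ.+-*-rawRing -Raw-AlmostCommutative⟶ fromCommutativeRing R
  morphism = record
    { ⟦_⟧ = ⟦_⟧ℤ ; +-homo = ⟦⟧-+ ; *-homo = ⟦⟧-* ; -‿homo = ⟦⟧-neg
    ; 0-homo = refl ; 1-homo = refl }

  -- Coefficients are compared as integers, which is decidable even where equality in the ring is
  -- not; only completeness of the solver can suffer.
  coefficients≟ : WeaklyDecidable (Induced-equivalence morphism)
  coefficients≟ i j with i ℤ.≟ j
  ... | yes ≡.refl = just refl
  ... | no  _      = nothing

  open import Algebra.Solver.Ring ℤ.+-*-rawRing (fromCommutativeRing R) morphism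
    coefficients≟ public using (solve; con; _:+_; _:*_; _:-_; :-_; _:=_; Polynomial)

  :0 :1 : ∀ {n} → Polynomial n
  :0 = con (+ 0)
  :1 = con (+ 1)

-- Alternating multilinear forms and the multiplicativity of the determinant

module Determinants {c ℓ} (R : CommutativeRing c ℓ) where
  open CommutativeRing R hiding (zero)
  open IntegerCoefficients R
  open Determinant rawRing
  open RawRing rawRing using (rawSemiring)
  open MatrixPower rawSemiring
  open import Algebra.Properties.Ring ring using (-‿distribˡ-*; -0#≈0#)
  open import Algebra.Properties.Group +-group using (inverseˡ-unique)
  open import Algebra.Properties.Semiring.Sum semiring
    using (sum; sum-cong-≋; ∑-distrib-+; *-distribˡ-sum; *-distribʳ-sum; sum-replicate-zero)
  open import Data.Unit.Polymorphic using (⊤; tt)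
  open import Data.Vec.Base using (map)
  import Data.Vec.Properties as Vec
  open import Data.Vec.Relation.Binary.Pointwise.Inductive as Pointwise using (Pointwise; []; _∷_)
  open import Data.Vec.Functional.Relation.Binary.Equality.Setoid setoid using (_≋_)
  open import Relation.Binary.Reasoning.Setoid setoid

  sum-zero : ∀ {n} (f : Vector Carrier n) → (∀ i → f i ≈ 0#) → sum f ≈ 0#
  sum-zero {n} f f≈0 = trans (sum-cong-≋ f≈0) (sum-replicate-zero n)

  -- The number of rows is independent of their length, because fixing the first row leaves a form
  -- in one row fewer of the same length. The recursive properties below all descend in this way.
  Form : ℕ → ℕ → Set c
  Form m n = Vec (Vector Carrier n) m → Carrier

  Congruent : ∀ {m n} → Form m n → Set (c ⊔ ℓ)
  Congruent D = ∀ {A B} → Pointwise _≋_ A B → D A ≈ D B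

  Linear : ∀ {n} → (Vector Carrier n → Carrier) → Set (c ⊔ ℓ)
  Linear f = ∀ a v w → f (λ j → a * v j + w j) ≈ a * f v + f w

  LinearMap : ∀ {m n} → (Vector Carrier m → Vector Carrier n) → Set (c ⊔ ℓ)
  LinearMap L = ∀ i → Linear (λ v → L v i)

  CongruentMap : ∀ {m n} → (Vector Carrier m → Vector Carrier n) → Set (c ⊔ ℓ)
  CongruentMap L = ∀ {v w} → v ≋ w → L v ≋ L w

  Multilinear : ∀ m {n} → Form m n → Set (c ⊔ ℓ)
  Multilinear zero    D = ⊤
  Multilinear (suc m) D =
    (∀ A → Linear (λ v → D (v ∷ A))) × (∀ v → Multilinear m (λ A → D (v ∷ A)))

  -- The row `e` may stand in any position. In `Alternating` it is the row just fixed, so that any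
  -- two equal rows count, not only adjacent ones.
  VanishesAt : ∀ {n} → Vector Carrier n → ∀ m → Form m n → Set (c ⊔ ℓ)
  VanishesAt e zero    D = ⊤
  VanishesAt e (suc m) D =
    (∀ A → D (e ∷ A) ≈ 0#) × (∀ v → VanishesAt e m (λ A → D (v ∷ A)))

  Alternating : ∀ m {n} → Form m n → Set (c ⊔ ℓ)
  Alternating zero    D = ⊤
  Alternating (suc m) D =
    ∀ v → VanishesAt v m (λ A → D (v ∷ A)) × Alternating m (λ A → D (v ∷ A))

  ≋ᴹ-refl : ∀ {m n} {A : Vec (Vector Carrier n) m} → Pointwise _≋_ A A
  ≋ᴹ-refl = Pointwise.refl (λ j → refl)

  congruent-∷ : ∀ {m n} {D : Form (suc m) n} → Congruent D → ∀ v → Congruent (λ A → D (v ∷ A))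
  congruent-∷ D-cong v A≋B = D-cong ((λ j → refl) ∷ A≋B)

  -- With its first row fixed, a Laplace expansion is such a combination of minors. Multilinearity
  -- and alternation of `det′` thus reduce to closure under combinations and under deletion of a
  -- column.
  combination : ∀ {k m n} → Vector Carrier k → (Fin k → Form m n) → Form m n
  combination a D A = sum (λ j → a j * D j A)

  linear-combination : ∀ {k n} (a : Vector Carrier k) (f : Fin k → Vector Carrier n → Carrier) →
                       (∀ j → Linear (f j)) → Linear (λ v → sum (λ j → a j * f j v))
  linear-combination a f f-lin b v w = begin
    sum (λ j → a j * f j (λ i → b * v i + w i))
      ≈⟨ sum-cong-≋ (λ j → trans (*-congˡ (f-lin j b v w))
           (solve 4 (λ a b x y → a :* (b :* x :+ y) := b :* (a :* x) :+ a :* y) refl (a j) b (f j v) (f j w))) ⟩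
    sum (λ j → b * (a j * f j v) + a j * f j w)
      ≈⟨ ∑-distrib-+ (λ j → b * (a j * f j v)) (λ j → a j * f j w) ⟩
    sum (λ j → b * (a j * f j v)) + sum (λ j → a j * f j w)
      ≈⟨ +-congʳ (*-distribˡ-sum b (λ j → a j * f j v)) ⟨
    b * sum (λ j → a j * f j v) + sum (λ j → a j * f j w) ∎

  multilinear-combination : ∀ {k} m {n} (a : Vector Carrier k) (D : Fin k → Form m n) →
                            (∀ j → Multilinear m (D j)) → Multilinear m (combination a D)
  multilinear-combination zero    a D D-ml = tt
  multilinear-combination (suc m) a D D-ml =
    (λ A → linear-combination a (λ j v → D j (v ∷ A)) (λ j → proj₁ (D-ml j) A)) ,
    (λ v → multilinear-combination m a (λ j A → D j (v ∷ A)) (λ j → proj₂ (D-ml j) v))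

  vanishesAt-combination : ∀ {k} m {n} {e : Vector Carrier n} (a : Vector Carrier k) (D : Fin k → Form m n) →
                           (∀ j → VanishesAt e m (D j)) → VanishesAt e m (combination a D)
  vanishesAt-combination zero    a D D-van = tt
  vanishesAt-combination (suc m) a D D-van =
    (λ A → sum-zero _ (λ j → trans (*-congˡ (proj₁ (D-van j) A)) (zeroʳ (a j)))) ,
    (λ v → vanishesAt-combination m a (λ j A → D j (v ∷ A)) (λ j → proj₂ (D-van j) v))

  alternating-combination : ∀ {k} m {n} (a : Vector Carrier k) (D : Fin k → Form m n) →
                            (∀ j → Alternating m (D j)) → Alternating m (combination a D)
  alternating-combination zero    a D D-alt = tt
  alternating-combination (suc m) a D D-alt v =
    vanishesAt-combination m a (λ j A → D j (v ∷ A)) (λ j → proj₁ (D-alt j v)) ,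
    alternating-combination m a (λ j A → D j (v ∷ A)) (λ j → proj₂ (D-alt j v))

  multilinear-map : ∀ m {n n′} {L : Vector Carrier n → Vector Carrier n′} {D : Form m n′} →
                    LinearMap L → Congruent D → Multilinear m D → Multilinear m (D ∘ map L)
  multilinear-map zero    L-lin D-cong D-ml = tt
  multilinear-map (suc m) {L = L} {D} L-lin D-cong D-ml =
    (λ A a v w → trans (D-cong ((λ i → L-lin i a v w) ∷ ≋ᴹ-refl)) (proj₁ D-ml (map L A) a (L v) (L w))) ,
    (λ v → multilinear-map m {D = λ A → D (L v ∷ A)} L-lin (congruent-∷ {D = D} D-cong (L v)) (proj₂ D-ml (L v)))

  vanishesAt-map : ∀ m {n n′} {L : Vector Carrier n → Vector Carrier n′} {D : Form m n′} {e} →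
                   VanishesAt (L e) m D → VanishesAt e m (D ∘ map L)
  vanishesAt-map zero    D-van = tt
  vanishesAt-map (suc m) {L = L} {D} (D-van₀ , D-van) =
    (λ A → D-van₀ (map L A)) , (λ v → vanishesAt-map m {D = λ A → D (L v ∷ A)} (D-van (L v)))

  alternating-map : ∀ m {n n′} {L : Vector Carrier n → Vector Carrier n′} {D : Form m n′} →
                    Alternating m D → Alternating m (D ∘ map L)
  alternating-map zero    D-alt = tt
  alternating-map (suc m) {L = L} {D} D-alt v =
    vanishesAt-map m {D = λ A → D (L v ∷ A)} (proj₁ (D-alt (L v))) ,
    alternating-map m {D = λ A → D (L v ∷ A)} (proj₂ (D-alt (L v)))

  vanishesAt-neg : ∀ m {n} {e : Vector Carrier n} {D D′ : Form m n} → (∀ A → D A ≈ - D′ A) →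
                   VanishesAt e m D′ → VanishesAt e m D
  vanishesAt-neg zero    D≈-D′ D′-van = tt
  vanishesAt-neg (suc m) D≈-D′ (D′-van₀ , D′-van) =
    (λ A → trans (D≈-D′ _) (trans (-‿cong (D′-van₀ A)) -0#≈0#)) ,
    (λ v → vanishesAt-neg m (λ A → D≈-D′ (v ∷ A)) (D′-van v))

  -- Polarisation: expand `g u u ≈ 0#` at `u = v + w`, written as `1# * v + w` to fit the single
  -- equation in `Linear`.
  antisymmetric : ∀ {n} (g : Vector Carrier n → Vector Carrier n → Carrier) →
                  (∀ w → Linear (λ v → g v w)) → (∀ v → Linear (g v)) → (∀ v → g v v ≈ 0#) →
                  ∀ v w → g v w ≈ - g w v
  antisymmetric g lin₁ lin₂ alt v w = inverseˡ-unique (g v w) (g w v) (begin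
    g v w + g w v
      ≈⟨ solve 2 (λ x y → x :+ y := :1 :* (:1 :* :0 :+ x) :+ (:1 :* y :+ :0)) refl (g v w) (g w v) ⟩
    1# * (1# * 0# + g v w) + (1# * g w v + 0#)
      ≈⟨ +-cong (*-congˡ (+-congʳ (*-congˡ (alt v)))) (+-congˡ (alt w)) ⟨
    1# * (1# * g v v + g v w) + (1# * g w v + g w w)
      ≈⟨ +-cong (*-congˡ (lin₂ v 1# v w)) (lin₂ w 1# v w) ⟨
    1# * g v u + g w u     ≈⟨ lin₁ u 1# v w ⟨
    g u u                  ≈⟨ alt u ⟩
    0#                     ∎)
    where
    u : Vector Carrier _
    u j = 1# * v j + w j

  -- The determinant on vectors of rows, for which consing a row is definitional.
  det′ : ∀ {n} → Form n n
  det′ {zero}  []      = 1#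
  det′ {suc n} (v ∷ A) = combination (λ j → sign j * v j) (λ j → det′ ∘ map (_∘ punchIn j)) A

  det′-cong : ∀ n → Congruent (det′ {n})
  det′-cong zero    []          = refl
  det′-cong (suc n) (v≋w ∷ A≋B) = sum-cong-≋ (λ j → *-cong (*-congˡ {sign j} (v≋w j))
    (det′-cong n (Pointwise.map⁺ (λ v≋w → v≋w ∘ punchIn j) A≋B)))

  det≈det′ : ∀ {n} (M : Matrix Carrier n) → det M ≈ det′ (tabulate M)
  det≈det′ {zero}  M = refl
  det≈det′ {suc n} M = sum-cong-≋ (λ j → *-congˡ {sign j * M zero j} (trans
    (det≈det′ (λ i k → M (suc i) (punchIn j k)))
    (reflexive (≡.cong det′ (Vec.tabulate-∘ (_∘ punchIn j) (M ∘ suc))))))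

  det′-multilinear : ∀ n → Multilinear n (det′ {n})
  det′-multilinear zero    = tt
  det′-multilinear (suc n) =
    (λ A a v w → begin
      sum (λ j → sign j * (a * v j + w j) * det′ (map (_∘ punchIn j) A))
        ≈⟨ sum-cong-≋ (λ j → solve 5 (λ s a x y d → s :* (a :* x :+ y) :* d := a :* (s :* x :* d) :+ s :* y :* d)
             refl (sign j) a (v j) (w j) (det′ (map (_∘ punchIn j) A))) ⟩
      sum (λ j → a * (sign j * v j * det′ (map (_∘ punchIn j) A)) + sign j * w j * det′ (map (_∘ punchIn j) A))
        ≈⟨ ∑-distrib-+ (λ j → a * (sign j * v j * det′ (map (_∘ punchIn j) A)))
             (λ j → sign j * w j * det′ (map (_∘ punchIn j) A)) ⟩
      _
        ≈⟨ +-congʳ (*-distribˡ-sum a (λ j → sign j * v j * det′ (map (_∘ punchIn j) A))) ⟨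
      a * det′ (v ∷ A) + det′ (w ∷ A) ∎) ,
    (λ v → multilinear-combination n (λ j → sign j * v j) (λ j → det′ ∘ map (_∘ punchIn j))
      (λ j → multilinear-map n {L = _∘ punchIn j} {D = det′} (λ i a v w → refl) (det′-cong n) (det′-multilinear n)))

  -- Deleting column j and then column k is the same as deleting column
  -- punchIn j k and then the one left of j; the two terms have opposite signs.
  double-expansion : ∀ n (a : Vector Carrier (suc (suc n))) (d : (Fin n → Fin (suc (suc n))) → Carrier) →
    (∀ {φ ψ} → φ ≗ ψ → d φ ≈ d ψ) →
    sum (λ j → sum (λ k → sign j * a j * (sign k * a (punchIn j k) * d (punchIn j ∘ punchIn k)))) ≈ 0#
  double-expansion n a d d-cong = begin
    sum (H zero) + sum (λ j → sum (H (suc j)))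
      ≈⟨ +-congˡ (∑-distrib-+ (λ j → H (suc j) zero) (λ j → sum (λ k → H (suc j) (suc k)))) ⟩
    sum (H zero) + (sum (λ j → H (suc j) zero) + sum (λ j → sum (λ k → H (suc j) (suc k))))
      ≈⟨ +-assoc _ _ _ ⟨
    sum (H zero) + sum (λ j → H (suc j) zero) + sum (λ j → sum (λ k → H (suc j) (suc k)))
      ≈⟨ +-cong (sym (∑-distrib-+ (H zero) (λ j → H (suc j) zero))) (rest n a d d-cong) ⟩
    sum (λ k → H zero k + H (suc k) zero) + 0#
      ≈⟨ +-congʳ (sum-zero _ cancel) ⟩
    0# + 0# ≈⟨ +-identityˡ 0# ⟩
    0#      ∎
    where
    H : Fin (suc (suc n)) → Fin (suc n) → Carrier
    H j k = sign j * a j * (sign k * a (punchIn j k) * d (punchIn j ∘ punchIn k))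
    cancel : ∀ k → H zero k + H (suc k) zero ≈ 0#
    cancel k = trans
      (+-congˡ (*-congˡ (*-congˡ (d-cong {ψ = suc ∘ punchIn k} (λ l → ≡.refl)))))
      (solve 4 (λ s x y z → :1 :* x :* (s :* y :* z) :+ (:- s) :* y :* (:1 :* x :* z) := :0)
        refl (sign k) (a zero) (a (suc k)) (d (suc ∘ punchIn k)))
    lift : ∀ {m n} → (Fin m → Fin n) → Fin (suc m) → Fin (suc n)
    lift φ zero    = zero
    lift φ (suc l) = suc (φ l)
    -- Both deleted columns lie beyond column zero, so that column survives (`lift`), the two sign
    -- changes cancel, and a double expansion with one column fewer remains.
    rest : ∀ n (a : Vector Carrier (suc (suc n))) (d : (Fin n → Fin (suc (suc n))) → Carrier) →
      (∀ {φ ψ} → φ ≗ ψ → d φ ≈ d ψ) →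
      sum {suc n} (λ j → sum {n} (λ k → sign (suc j) * a (suc j) *
        (sign (suc k) * a (suc (punchIn j k)) * d (punchIn (suc j) ∘ punchIn (suc k))))) ≈ 0#
    rest zero    a d d-cong = +-identityˡ 0#
    rest (suc n) a d d-cong = trans
      (sum-cong-≋ (λ j → sum-cong-≋ (λ k → trans
        (*-congˡ (*-congˡ (d-cong {φ = punchIn (suc j) ∘ punchIn (suc k)} {ψ = lift (punchIn j ∘ punchIn k)}
          λ { zero → ≡.refl ; (suc l) → ≡.refl })))
        (solve 5 (λ s t x y z → (:- s) :* x :* ((:- t) :* y :* z) := s :* x :* (t :* y :* z))
          refl (sign j) (sign k) (a (suc j)) (a (suc (punchIn j k))) (d (lift (punchIn j ∘ punchIn k)))))))
      (double-expansion n (a ∘ suc) (d ∘ lift)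
        (λ φ≗ψ → d-cong λ { zero → ≡.refl ; (suc l) → ≡.cong suc (φ≗ψ l) }))

  det′-repeated : ∀ {n} (v : Vector Carrier (suc (suc n))) A → det′ (v ∷ v ∷ A) ≈ 0#
  det′-repeated {n} v A = trans
    (sum-cong-≋ (λ j → trans
      (*-distribˡ-sum (sign j * v j) (λ k → sign k * v (punchIn j k) * det′ (map (_∘ punchIn k) (map (_∘ punchIn j) A))))
      (sum-cong-≋ (λ k → *-congˡ {sign j * v j} (*-congˡ {sign k * v (punchIn j k)}
        (reflexive (≡.cong det′ (≡.sym (Vec.map-∘ (_∘ punchIn k) (_∘ punchIn j) A)))))))))
    (double-expansion n v (λ φ → det′ (map (_∘ φ) A))
      (λ {φ} {ψ} φ≗ψ → det′-cong n (columns φ≗ψ A)))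
    where
    columns : ∀ {k m n} {φ ψ : Fin k → Fin n} → φ ≗ ψ → (A : Vec (Vector Carrier n) m) →
              Pointwise _≋_ (map (_∘ φ) A) (map (_∘ ψ) A)
    columns φ≗ψ []      = []
    columns φ≗ψ (w ∷ A) = (λ l → reflexive (≡.cong w (φ≗ψ l))) ∷ columns φ≗ψ A

  -- A repetition in the second row is `det′-repeated`. If `v` recurs further down, swap it with the
  -- second row `w` and expand along `w`: every minor then has a restriction of `v` as its first row
  -- and again further down, and induction applies.
  det′-alternating : ∀ n → Alternating n (det′ {n})
  det′-alternating zero          = tt
  det′-alternating (suc zero)  v = tt , tt
  det′-alternating (suc n@(suc m)) v =
    (det′-repeated v ,
     λ w → vanishesAt-neg m
       (λ A → antisymmetric (λ v w → det′ (v ∷ w ∷ A)) (λ w → proj₁ (det′-multilinear (suc n)) (w ∷ A))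
         (λ v → proj₁ (proj₂ (det′-multilinear (suc n)) v) A) (λ v → det′-repeated v A) v w)
       (vanishesAt-combination m (λ j → sign j * w j) (λ j A → det′ (v ∘ punchIn j ∷ map (_∘ punchIn j) A))
         (λ j → vanishesAt-map m {L = _∘ punchIn j} {D = λ A → det′ (v ∘ punchIn j ∷ A)}
         (proj₁ (det′-alternating n (v ∘ punchIn j)))))) ,
    alternating-combination n (λ j → sign j * v j) (λ j → det′ ∘ map (_∘ punchIn j))
      (λ j → alternating-map n {L = _∘ punchIn j} {D = det′} (det′-alternating n))

  insert0 : ∀ {n} → Fin (suc n) → Vector Carrier n → Vector Carrier (suc n)
  insert0 j v = insertAt v j 0#

  insert0-cong : ∀ {n} (j : Fin (suc n)) → CongruentMap (insert0 j)
  insert0-cong         zero    v≋w zero    = refl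
  insert0-cong         zero    v≋w (suc i) = v≋w i
  insert0-cong {suc n} (suc j) v≋w zero    = v≋w zero
  insert0-cong {suc n} (suc j) v≋w (suc i) = insert0-cong j (v≋w ∘ suc) i

  insert0-linear : ∀ {n} (j : Fin (suc n)) → LinearMap (insert0 j)
  insert0-linear         zero    zero    a v w = solve 1 (λ a → :0 := a :* :0 :+ :0) refl a
  insert0-linear         zero    (suc i) a v w = refl
  insert0-linear {suc n} (suc j) zero    a v w = refl
  insert0-linear {suc n} (suc j) (suc i) a v w = insert0-linear j i a (v ∘ suc) (w ∘ suc)

  insert0-identity : ∀ {n} j (i : Fin n) → insert0 j (identity i) ≋ identity (punchIn j i)
  insert0-identity zero    i       zero    = refl
  insert0-identity zero    i       (suc k) = refl
  insert0-identity (suc j) zero    zero    = refl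
  insert0-identity (suc j) zero    (suc k) = zero-row j k
    where
    zero-row : ∀ {n} (j : Fin (suc n)) → insert0 j (λ _ → 0#) ≋ (λ _ → 0#)
    zero-row         zero    zero    = refl
    zero-row         zero    (suc k) = refl
    zero-row {suc n} (suc j) zero    = refl
    zero-row {suc n} (suc j) (suc k) = zero-row j k
  insert0-identity (suc j) (suc i) zero    = refl
  insert0-identity (suc j) (suc i) (suc k) = insert0-identity j i k

  -- Clearing coordinate `j` amounts to adding a multiple of a basis vector, so it is invisible to
  -- forms that vanish at that vector.
  insert0-punchIn : ∀ {n} j (v : Vector Carrier (suc n)) →
                    insert0 j (v ∘ punchIn j) ≋ (λ i → - v j * identity j i + v i)
  insert0-punchIn         zero    v zero    = solve 1 (λ x → :0 := (:- x) :* :1 :+ x) refl (v zero)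
  insert0-punchIn         zero    v (suc i) = solve 2 (λ x y → y := (:- x) :* :0 :+ y) refl (v zero) (v (suc i))
  insert0-punchIn {suc n} (suc j) v zero    = solve 2 (λ x y → y := (:- x) :* :0 :+ y) refl (v (suc j)) (v zero)
  insert0-punchIn {suc n} (suc j) v (suc i) = insert0-punchIn j (v ∘ suc) i

  linear-expansion : ∀ n (f : Vector Carrier n → Carrier) → (∀ {v w} → v ≋ w → f v ≈ f w) → Linear f →
                     ∀ v → f v ≈ sum (λ j → v j * f (identity j))
  linear-expansion zero f f-cong f-lin v = begin
    -- At length zero all vectors agree, so `v` may be replaced by `- v + v`, and linearity cancels
    -- the two values.
    f v                              ≈⟨ f-cong (λ ()) ⟩
    f (λ j → - 1# * v j + v j)       ≈⟨ f-lin (- 1#) v v ⟩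
    - 1# * f v + f v                 ≈⟨ solve 1 (λ x → (:- :1) :* x :+ x := :0) refl (f v) ⟩
    0#                               ∎
  linear-expansion (suc n) f f-cong f-lin v = begin
    f v
      ≈⟨ f-cong (λ { zero → solve 1 (λ x → x := x :* :1 :+ :0) refl (v zero)
                   ; (suc j) → solve 2 (λ x y → y := x :* :0 :+ y) refl (v zero) (v (suc j)) }) ⟩
    f (λ j → v zero * identity zero j + insert0 zero (v ∘ suc) j)
      ≈⟨ f-lin (v zero) (identity zero) (insert0 zero (v ∘ suc)) ⟩
    v zero * f (identity zero) + f (insert0 zero (v ∘ suc))
      ≈⟨ +-congˡ (linear-expansion n (f ∘ insert0 zero) (f-cong ∘ insert0-cong zero)
           (λ a v w → trans (f-cong (λ i → insert0-linear zero i a v w)) (f-lin a _ _)) (v ∘ suc)) ⟩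
    v zero * f (identity zero) + sum (λ j → v (suc j) * f (insert0 zero (identity j)))
      ≈⟨ +-congˡ (sum-cong-≋ (λ j → *-congˡ {v (suc j)} (f-cong (insert0-identity zero j)))) ⟩
    v zero * f (identity zero) + sum (λ j → v (suc j) * f (identity (suc j))) ∎

  -- Row by row, linearity splits off a multiple of a value of `D` with row `e`, which is zero.
  vanishesAt-shear : ∀ m {n} {e : Vector Carrier n} {D : Form m n} → Congruent D → Multilinear m D →
                     VanishesAt e m D → (b : Vector Carrier n → Carrier) (L : Vector Carrier n → Vector Carrier n) →
                     (∀ v → L v ≋ (λ i → b v * e i + v i)) → ∀ A → D (map L A) ≈ D A
  vanishesAt-shear zero    D-cong D-ml D-van b L L≋ [] = refl
  vanishesAt-shear (suc m) {e = e} {D} D-cong (D-lin , D-ml) (D-van₀ , D-van) b L L≋ (v ∷ A) = begin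
    D (L v ∷ map L A)
      ≈⟨ vanishesAt-shear m {D = λ A → D (L v ∷ A)} (congruent-∷ {D = D} D-cong (L v)) (D-ml (L v)) (D-van (L v)) b L L≋ A ⟩
    D (L v ∷ A)                          ≈⟨ D-cong (L≋ v ∷ ≋ᴹ-refl) ⟩
    D ((λ i → b v * e i + v i) ∷ A)      ≈⟨ D-lin A (b v) e v ⟩
    b v * D (e ∷ A) + D (v ∷ A)          ≈⟨ +-congʳ (*-congˡ (D-van₀ A)) ⟩
    b v * 0# + D (v ∷ A)                 ≈⟨ +-congʳ (zeroʳ (b v)) ⟩
    0# + D (v ∷ A)                       ≈⟨ +-identityˡ _ ⟩
    D (v ∷ A)                            ∎

  -- Row `j` is carried up by `j` adjacent transpositions, each of which contributes a sign.
  move-to-front : ∀ {n k} (D : Form (suc n) k) → Multilinear (suc n) D → Alternating (suc n) D →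
                  (b : Fin (suc n) → Vector Carrier k) (j : Fin (suc n)) →
                  D (b j ∷ tabulate (b ∘ punchIn j)) ≈ sign j * D (tabulate b)
  move-to-front         D D-ml D-alt b zero    = sym (*-identityˡ _)
  move-to-front {suc n} D D-ml@(D-lin , D-ml′) D-alt b (suc j) = begin
    D (b (suc j) ∷ b zero ∷ A)
      ≈⟨ antisymmetric (λ v w → D (v ∷ w ∷ A)) (λ w → D-lin (w ∷ A)) (λ v → proj₁ (D-ml′ v) A)
           (λ v → proj₁ (proj₁ (D-alt v)) A) (b (suc j)) (b zero) ⟩
    - D (b zero ∷ b (suc j) ∷ A)
      ≈⟨ -‿cong (move-to-front (λ A → D (b zero ∷ A)) (D-ml′ (b zero)) (proj₂ (D-alt (b zero))) (b ∘ suc) j) ⟩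
    - (sign j * D (tabulate b))
      ≈⟨ -‿distribˡ-* _ _ ⟩
    - sign j * D (tabulate b) ∎
    where
    A : Vec (Vector Carrier _) n
    A = tabulate (λ i → b (suc (punchIn j i)))

  -- Expand the first row in basis vectors. Once it is `identity j`, column `j` of the other rows
  -- can be cleared by a shear, so `D` depends only on the rows of a minor; by induction it is that
  -- minor times a constant, which `move-to-front` evaluates as `sign j * D (tabulate identity)`.
  -- The sum over `j` is the Laplace expansion.
  alternating-unique : ∀ n (D : Form n n) → Congruent D → Multilinear n D → Alternating n D →
                       ∀ A → D A ≈ det′ A * D (tabulate identity)
  alternating-unique zero    D D-cong D-ml D-alt []      = sym (*-identityˡ _)
  alternating-unique (suc n) D D-cong D-ml@(D-lin , D-ml′) D-alt (v ∷ A) = begin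
    D (v ∷ A)
      ≈⟨ linear-expansion (suc n) (λ v → D (v ∷ A)) (λ v≋w → D-cong (v≋w ∷ ≋ᴹ-refl)) (D-lin A) v ⟩
    sum (λ j → v j * D (identity j ∷ A))
      ≈⟨ sum-cong-≋ (λ j → trans (*-congˡ {v j} (row j))
           (solve 4 (λ x s d y → x :* (d :* (s :* y)) := s :* x :* d :* y) refl
              (v j) (sign j) (det′ (map (_∘ punchIn j) A)) (D (tabulate identity)))) ⟩
    sum (λ j → sign j * v j * det′ (map (_∘ punchIn j) A) * D (tabulate identity))
      ≈⟨ *-distribʳ-sum (D (tabulate identity)) (λ j → sign j * v j * det′ (map (_∘ punchIn j) A)) ⟨
    det′ (v ∷ A) * D (tabulate identity) ∎
    where
    row : ∀ j → D (identity j ∷ A) ≈ det′ (map (_∘ punchIn j) A) * (sign j * D (tabulate identity))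
    row j = begin
      E A
        ≈⟨ vanishesAt-shear n {D = E} E-cong (D-ml′ (identity j)) (proj₁ (D-alt (identity j))) (λ v → - v j)
             (insert0 j ∘ (_∘ punchIn j)) (insert0-punchIn j) A ⟨
      E (map (insert0 j ∘ (_∘ punchIn j)) A)
        ≡⟨ ≡.cong E (Vec.map-∘ (insert0 j) (_∘ punchIn j) A) ⟩
      E (map (insert0 j) (map (_∘ punchIn j) A))
        ≈⟨ alternating-unique n (E ∘ map (insert0 j))
             (λ A≋B → E-cong (Pointwise.map⁺ (insert0-cong j) A≋B))
             (multilinear-map n {D = E} (insert0-linear j) E-cong (D-ml′ (identity j)))
             (alternating-map n {D = E} (proj₂ (D-alt (identity j)))) (map (_∘ punchIn j) A) ⟩
      det′ (map (_∘ punchIn j) A) * E (map (insert0 j) (tabulate identity))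
        ≡⟨ ≡.cong (λ B → det′ (map (_∘ punchIn j) A) * E B) (≡.sym (Vec.tabulate-∘ (insert0 j) identity)) ⟩
      det′ (map (_∘ punchIn j) A) * E (tabulate (insert0 j ∘ identity))
        ≈⟨ *-congˡ (E-cong (Pointwise.tabulate⁺ (insert0-identity j))) ⟩
      det′ (map (_∘ punchIn j) A) * E (tabulate (identity ∘ punchIn j))
        ≈⟨ *-congˡ (move-to-front D D-ml D-alt identity j) ⟩
      det′ (map (_∘ punchIn j) A) * (sign j * D (tabulate identity)) ∎
      where
      E : Form n (suc n)
      E A = D (identity j ∷ A)
      E-cong : Congruent E
      E-cong = congruent-∷ {D = D} D-cong (identity j)

  sum-identityˡ : ∀ {n} (i : Fin n) (v : Vector Carrier n) → sum (λ k → identity i k * v k) ≈ v i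
  sum-identityˡ zero    v = trans (+-cong (*-identityˡ _) (sum-zero (λ k → 0# * v (suc k)) (λ k → zeroˡ _)))
                                  (+-identityʳ _)
  sum-identityˡ (suc i) v = trans (+-cong (zeroˡ _) (sum-identityˡ i (v ∘ suc))) (+-identityˡ _)

  identity-symmetric : ∀ {n} (i j : Fin n) → identity i j ≡ identity j i
  identity-symmetric zero    zero    = ≡.refl
  identity-symmetric zero    (suc j) = ≡.refl
  identity-symmetric (suc i) zero    = ≡.refl
  identity-symmetric (suc i) (suc j) = identity-symmetric i j

  identity-diagonal : ∀ {n} (i : Fin n) → identity i i ≈ 1#
  identity-diagonal zero    = refl
  identity-diagonal (suc i) = identity-diagonal i

  sum-identityʳ : ∀ {n} (j : Fin n) (v : Vector Carrier n) → sum (λ k → v k * identity k j) ≈ v j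
  sum-identityʳ j v = trans
    (sum-cong-≋ (λ k → trans (*-comm (v k) _) (*-congʳ {v k} (reflexive (identity-symmetric k j)))))
    (sum-identityˡ j v)

  det-cong : ∀ {n} {M N : Matrix Carrier n} → (∀ i j → M i j ≈ N i j) → det M ≈ det N
  det-cong {n} {M} {N} M≈N = trans (det≈det′ M) (trans
    (det′-cong n (Pointwise.tabulate⁺ M≈N)) (sym (det≈det′ N)))

  -- As a function of the rows of `M` the left side is alternating and multilinear, and at the
  -- identity its value is `det N`.
  det-⊗ : ∀ {n} (M N : Matrix Carrier n) → det (M ⊗ N) ≈ det M * det N
  det-⊗ {n} M N = begin
    det (M ⊗ N)                              ≈⟨ det≈det′ (M ⊗ N) ⟩
    det′ (tabulate (timesN ∘ M))             ≡⟨ ≡.cong det′ (Vec.tabulate-∘ timesN M) ⟩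
    det′ (map timesN (tabulate M))
      ≈⟨ alternating-unique n (det′ ∘ map timesN) (λ A≋B → det′-cong n (Pointwise.map⁺ timesN-cong A≋B))
           (multilinear-map n {D = det′} timesN-linear (det′-cong n) (det′-multilinear n))
           (alternating-map n {D = det′} (det′-alternating n)) (tabulate M) ⟩
    det′ (tabulate M) * det′ (map timesN (tabulate identity))
      ≡⟨ ≡.cong (λ A → det′ (tabulate M) * det′ A) (≡.sym (Vec.tabulate-∘ timesN identity)) ⟩
    det′ (tabulate M) * det′ (tabulate (timesN ∘ identity))
      ≈⟨ *-congˡ (det′-cong n (Pointwise.tabulate⁺ (λ i j → sum-identityˡ i (λ k → N k j)))) ⟩
    det′ (tabulate M) * det′ (tabulate N)    ≈⟨ *-cong (det≈det′ M) (det≈det′ N) ⟨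
    det M * det N                            ∎
    where
    timesN : Vector Carrier n → Vector Carrier n
    timesN v j = sum (λ k → v k * N k j)
    timesN-cong : CongruentMap timesN
    timesN-cong v≋w j = sum-cong-≋ (λ k → *-congʳ {N k j} (v≋w k))
    timesN-linear : LinearMap timesN
    timesN-linear j a v w = begin
      sum (λ k → (a * v k + w k) * N k j)
        ≈⟨ sum-cong-≋ (λ k → solve 4 (λ a x y z → (a :* x :+ y) :* z := a :* (x :* z) :+ y :* z)
             refl a (v k) (w k) (N k j)) ⟩
      sum (λ k → a * (v k * N k j) + w k * N k j)
        ≈⟨ ∑-distrib-+ (λ k → a * (v k * N k j)) (λ k → w k * N k j) ⟩
      sum (λ k → a * (v k * N k j)) + timesN w j
        ≈⟨ +-congʳ (*-distribˡ-sum a (λ k → v k * N k j)) ⟨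
      a * timesN v j + timesN w j ∎

-- Order, apartness and sums of squares

module OrderedField {c ℓ₁ ℓ₂} (ℝ : RealNumbers c ℓ₁ ℓ₂) where
  open RealNumbers ℝ using (heytingField; commutativeRing; _<_; isStrictPartialOrder; #⇔<⊎>; +-monoˡ-<; *-pos; _·_)
  open HeytingField heytingField
    using (_#_; #⇒invertible; tight; #-sym; #-irrefl; #-cotrans; heytingCommutativeRing) public
  open import Algebra.Apartness.Properties.HeytingCommutativeRing heytingCommutativeRing
    using (1#0; #-congʳ; x#0y#0→xy#0; x-0≈x) public
  open CommutativeRing commutativeRing hiding (zero)
  open IntegerCoefficients commutativeRing
  open import Algebra.Properties.Ring ring using (x[y-z]≈xy-xz)
  open import Algebra.Properties.Group +-group public
    using () renaming (x∙y⁻¹≈ε⇒x≈y to x-y≈0⇒x≈y; x≈y⇒x∙y⁻¹≈ε to x≈y⇒x-y≈0)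
  open IsStrictPartialOrder isStrictPartialOrder
    using (<-respˡ-≈; <-respʳ-≈) renaming (trans to <-trans; irrefl to <-irrefl; asym to <-asym)
  open import Algebra.Properties.Semiring.Mult semiring using (×-homo-+; ×1-homo-*)
  open import Algebra.Properties.Semiring.Exp semiring using (_^_)
  open import Algebra.Properties.Semiring.Sum semiring using (sum)

  <⇒# : ∀ {x y} → x < y → x # y
  <⇒# x<y = Equivalence.from (#⇔<⊎> _ _) (inj₁ x<y)

  neg-pos : ∀ {x} → x < 0# → 0# < - x
  neg-pos {x} x<0 = <-respˡ-≈ (-‿inverseʳ x) (<-respʳ-≈ (+-identityˡ (- x)) (+-monoˡ-< (- x) x<0))

  square-pos : ∀ {x} → x # 0# → 0# < x * x
  square-pos {x} x#0 with Equivalence.to (#⇔<⊎> x 0#) x#0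
  ... | inj₂ 0<x = *-pos 0<x 0<x
  ... | inj₁ x<0 = <-respʳ-≈ (solve 1 (λ x → (:- x) :* (:- x) := x :* x) refl x) (*-pos (neg-pos x<0) (neg-pos x<0))

  0<1 : 0# < 1#
  0<1 = <-respʳ-≈ (*-identityˡ 1#) (square-pos 1#0)

  ι : ℕ → Carrier
  ι n = n · 1#

  ι-+ : ∀ m n → ι (m ℕ.+ n) ≈ ι m + ι n
  ι-+ = ×-homo-+ 1#

  ι-* : ∀ m n → ι (m ℕ.* n) ≈ ι m * ι n
  ι-* = ×1-homo-*

  ι-mono : ∀ {m n} → m ℕ.< n → ι m < ι n
  ι-mono {m} {suc n} m<1+n with ℕ.m≤n⇒m<n∨m≡n (ℕ.≤-pred m<1+n)
  ... | inj₂ ≡.refl = <-respˡ-≈ (+-identityˡ (ι n)) (+-monoˡ-< (ι n) 0<1)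
  ... | inj₁ m<n    = <-trans (ι-mono m<n) (<-respˡ-≈ (+-identityˡ (ι n)) (+-monoˡ-< (ι n) 0<1))

  ι-# : ∀ {m n} → m ℕ.< n → ι n # ι m
  ι-# m<n = #-sym (<⇒# (ι-mono m<n))

  ι-injective : ∀ {m n} → ι m ≈ ι n → m ≡ n
  ι-injective {m} {n} ιm≈ιn with ℕ.<-cmp m n
  ... | tri< m<n _ _ = ⊥-elim (<-irrefl ιm≈ιn (ι-mono m<n))
  ... | tri≈ _ m≡n _ = m≡n
  ... | tri> _ _ n<m = ⊥-elim (<-irrefl (sym ιm≈ιn) (ι-mono n<m))

  cancel-# : ∀ {a b x} → a # b → (a - b) * x ≈ 0# → x ≈ 0#
  cancel-# {a} {b} {x} a#b ab*x≈0 with #⇒invertible a#b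
  ... | a⁻¹ , a⁻¹*a≈1 , _ = trans (sym (*-identityˡ x)) (trans (*-congʳ (sym a⁻¹*a≈1))
          (trans (*-assoc _ _ _) (trans (*-congˡ ab*x≈0) (zeroʳ a⁻¹))))

  cancel-#0 : ∀ {a x} → a # 0# → a * x ≈ 0# → x ≈ 0#
  cancel-#0 a#0 ax≈0 = cancel-# a#0 (trans (*-congʳ (x-0≈x _)) ax≈0)

  cancelˡ-#0 : ∀ {a x y} → a # 0# → a * x ≈ a * y → x ≈ y
  cancelˡ-#0 {a} {x} {y} a#0 ax≈ay = x-y≈0⇒x≈y x y
    (cancel-#0 a#0 (trans (x[y-z]≈xy-xz a x y) (x≈y⇒x-y≈0 ax≈ay)))

  ^-#0 : ∀ {s} k → s # 0# → s ^ k # 0#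
  ^-#0 zero    s#0 = 1#0
  ^-#0 (suc k) s#0 = x#0y#0→xy#0 s#0 (^-#0 k s#0)

  -- A negation, because the disjunction of `0# < x` and `x ≈ 0#` cannot be decided constructively,
  -- not even for squares.
  Nonnegative : Carrier → Set ℓ₂
  Nonnegative x = ¬ x < 0#

  +-shift : ∀ {x y} → x + y < 0# → 0# < x → y < 0#
  +-shift {x} {y} x+y<0 0<x = <-trans (<-respˡ-≈ (+-identityˡ y) (+-monoˡ-< y 0<x)) x+y<0

  -- Cotransitivity replaces a case distinction on the sign of `x`: since `x + y` is apart from
  -- `0#`, `x` is apart from one of the two, and each resulting order relation makes `x` or `y`
  -- negative.
  +-nonnegative : ∀ {x y} → Nonnegative x → Nonnegative y → Nonnegative (x + y)
  +-nonnegative {x} {y} x≥0 y≥0 x+y<0 with #-cotrans (<⇒# x+y<0) x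
  ... | inj₂ x#0 with Equivalence.to (#⇔<⊎> x 0#) x#0
  ...   | inj₁ x<0 = x≥0 x<0
  ...   | inj₂ 0<x = y≥0 (+-shift x+y<0 0<x)
  +-nonnegative {x} {y} x≥0 y≥0 x+y<0 | inj₁ x+y#x with Equivalence.to (#⇔<⊎> (x + y) x) x+y#x
  ... | inj₁ x+y<x = y≥0 (<-respˡ-≈ (solve 2 (λ x y → x :+ y :+ (:- x) := y) refl x y)
                       (<-respʳ-≈ (-‿inverseʳ x) (+-monoˡ-< (- x) x+y<x)))
  ... | inj₂ x<x+y = x≥0 (<-trans x<x+y x+y<0)

  square-nonnegative : ∀ x → Nonnegative (x * x)
  square-nonnegative x xx<0 = <-irrefl (trans (*-congʳ x≈0) (zeroˡ x)) xx<0
    where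
    x≈0 : x ≈ 0#
    x≈0 = proj₁ (tight x 0#) (λ x#0 → <-asym (square-pos x#0) xx<0)

  sum-nonnegative : ∀ {n} (f : Vector Carrier n) → (∀ i → Nonnegative (f i)) → Nonnegative (sum f)
  sum-nonnegative {zero}  f f≥0 = <-irrefl refl
  sum-nonnegative {suc n} f f≥0 = +-nonnegative (f≥0 zero) (sum-nonnegative (f ∘ suc) (f≥0 ∘ suc))

  -- A positive `x` would make `y` negative. Tightness turns this refutation of `x # 0#` into an
  -- equality.
  +-nonnegative-zero : ∀ {x y} → Nonnegative x → Nonnegative y → x + y ≈ 0# → x ≈ 0# × y ≈ 0#
  +-nonnegative-zero {x} {y} x≥0 y≥0 x+y≈0 = zero-of x≥0 y≥0 x+y≈0 , zero-of y≥0 x≥0 (trans (+-comm y x) x+y≈0)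
    where
    zero-of : ∀ {x y} → Nonnegative x → Nonnegative y → x + y ≈ 0# → x ≈ 0#
    zero-of {x} {y} x≥0 y≥0 x+y≈0 = proj₁ (tight x 0#) λ x#0 → contra (Equivalence.to (#⇔<⊎> x 0#) x#0)
      where
      contra : x < 0# ⊎ 0# < x → ⊥
      contra (inj₁ x<0) = x≥0 x<0
      contra (inj₂ 0<x) = y≥0 (<-respˡ-≈ (+-identityˡ y) (<-respʳ-≈ x+y≈0 (+-monoˡ-< y 0<x)))

  sum-nonnegative-zero : ∀ {n} (f : Vector Carrier n) → (∀ i → Nonnegative (f i)) → sum f ≈ 0# → ∀ i → f i ≈ 0#
  sum-nonnegative-zero {suc n} f f≥0 Σf≈0 i
    with +-nonnegative-zero (f≥0 zero) (sum-nonnegative (f ∘ suc) (f≥0 ∘ suc)) Σf≈0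
  sum-nonnegative-zero f f≥0 Σf≈0 zero    | f₀≈0 , _   = f₀≈0
  sum-nonnegative-zero f f≥0 Σf≈0 (suc i) | _ , Σf′≈0 = sum-nonnegative-zero (f ∘ suc) (f≥0 ∘ suc) Σf′≈0 i

  square-zero : ∀ {x} → x * x ≈ 0# → x ≈ 0#
  square-zero {x} xx≈0 = proj₁ (tight x 0#) λ x#0 → <-irrefl (sym xx≈0) (square-pos x#0)

-- Polynomial functions, their zeros and their first-order expansions

module PolynomialFunctions {c ℓ₁ ℓ₂} (ℝ : RealNumbers c ℓ₁ ℓ₂) where
  open RealNumbers ℝ using (commutativeRing)
  open CommutativeRing commutativeRing hiding (zero)
  open IntegerCoefficients commutativeRing
  open OrderedField ℝ
  open import Algebra.Properties.Semiring.Sum semiring using (sum)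
  open import Relation.Binary.Reasoning.Setoid setoid

  -- A coefficient-free encoding: dividing F (t) − F (a) by t − a, at any points a,
  -- leads to a constant after finitely many steps.
  data IsPolynomial (F : Carrier → Carrier) : Set (c ⊔ ℓ₁) where
    constant : ∀ a → (∀ t → F t ≈ a) → IsPolynomial F
    divided  : (∀ a → ∃[ G ] IsPolynomial G × (∀ t → F t ≈ F a + (t - a) * G t)) → IsPolynomial F

  divide : ∀ {F} → IsPolynomial F → ∀ a → ∃[ G ] IsPolynomial G × (∀ t → F t ≈ F a + (t - a) * G t)
  divide (constant b F≈b) a = (λ _ → 0#) , constant 0# (λ _ → refl) , λ t → trans (F≈b t)
    (trans (sym (F≈b a)) (solve 3 (λ y t a → y := y :+ (t :- a) :* :0) refl _ t a))
  divide (divided F÷) a = F÷ a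

  poly-const : ∀ a → IsPolynomial (λ _ → a)
  poly-const a = constant a (λ _ → refl)

  poly-id : IsPolynomial id
  poly-id = divided λ a → (λ _ → 1#) , poly-const 1# ,
    λ t → solve 2 (λ t a → t := a :+ (t :- a) :* :1) refl t a

  poly-resp : ∀ {F G} → (∀ t → F t ≈ G t) → IsPolynomial F → IsPolynomial G
  poly-resp F≈G (constant a F≈a) = constant a (λ t → trans (sym (F≈G t)) (F≈a t))
  poly-resp F≈G (divided F÷) = divided λ a → let (Q , Q-poly , F≈) = F÷ a in
    Q , Q-poly , λ t → trans (sym (F≈G t)) (trans (F≈ t) (+-congʳ (F≈G a)))

  -- A bare function on the carrier need not respect `_≈_`; here the factor `s - t` in the division
  -- at `t` forces it.
  poly-cong : ∀ {F} → IsPolynomial F → ∀ {s t} → s ≈ t → F s ≈ F t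
  poly-cong {F} F-poly {s} {t} s≈t with divide F-poly t
  ... | Q , _ , F≈ = begin
    F s                    ≈⟨ F≈ s ⟩
    F t + (s - t) * Q s    ≈⟨ +-congˡ (*-congʳ (+-congʳ s≈t)) ⟩
    F t + (t - t) * Q s    ≈⟨ solve 3 (λ f t q → f :+ (t :- t) :* q := f) refl (F t) t (Q s) ⟩
    F t                    ∎

  poly-+ : ∀ {F G} → IsPolynomial F → IsPolynomial G → IsPolynomial (λ t → F t + G t)
  poly-+ (constant a F≈a) (constant b G≈b) = constant (a + b) (λ t → +-cong (F≈a t) (G≈b t))
  poly-+ {F} {G} (constant b F≈b) (divided G÷) = divided λ a → let (P , P-poly , G≈) = G÷ a in
    P , P-poly , λ t → trans (+-cong (trans (F≈b t) (sym (F≈b a))) (G≈ t)) (sym (+-assoc _ _ _))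
  poly-+ {F} {G} (divided F÷) (constant b G≈b) = divided λ a → let (Q , Q-poly , F≈) = F÷ a in
    Q , Q-poly , λ t → trans (+-cong (F≈ t) (trans (G≈b t) (sym (G≈b a))))
      (solve 3 (λ f q g → f :+ q :+ g := f :+ g :+ q) refl (F a) _ (G a))
  poly-+ {F} {G} (divided F÷) (divided G÷) = divided λ a →
    let (Q , Q-poly , F≈) = F÷ a ; (P , P-poly , G≈) = G÷ a in
    (λ t → Q t + P t) , poly-+ Q-poly P-poly , λ t → trans (+-cong (F≈ t) (G≈ t))
      (solve 5 (λ f g x q p → f :+ x :* q :+ (g :+ x :* p) := f :+ g :+ x :* (q :+ p))
         refl (F a) (G a) (t - a) (Q t) (P t))

  poly-scale : ∀ {F} b → IsPolynomial F → IsPolynomial (λ t → b * F t)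
  poly-scale     b (constant a F≈a) = constant (b * a) (λ t → *-congˡ (F≈a t))
  poly-scale {F} b (divided F÷) = divided λ a → let (Q , Q-poly , F≈) = F÷ a in
    (λ t → b * Q t) , poly-scale b Q-poly , λ t → trans (*-congˡ (F≈ t))
      (solve 4 (λ b f x q → b :* (f :+ x :* q) := b :* f :+ x :* (b :* q)) refl b (F a) (t - a) (Q t))

  -- The quotient `Q t * G t + F a * P t` is asymmetric on purpose: its only product of polynomials
  -- has `Q`, smaller than `F`, as first factor, and the other summand is a scaling. So the
  -- recursion descends on the first factor alone.
  poly-* : ∀ {F G} → IsPolynomial F → IsPolynomial G → IsPolynomial (λ t → F t * G t)
  poly-* (constant b F≈b) G-poly = poly-resp (λ t → *-congʳ (sym (F≈b t))) (poly-scale b G-poly)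
  poly-* {F} {G} F-poly@(divided _) (constant b G≈b) =
    poly-resp (λ t → trans (*-comm b (F t)) (*-congˡ (sym (G≈b t)))) (poly-scale b F-poly)
  poly-* {F} {G} (divided F÷) G-poly@(divided G÷) = divided λ a →
    let (Q , Q-poly , F≈) = F÷ a ; (P , P-poly , G≈) = G÷ a in
    (λ t → Q t * G t + F a * P t) , poly-+ (poly-* Q-poly G-poly) (poly-scale (F a) P-poly) ,
    λ t → begin
      F t * G t
        ≈⟨ *-congʳ (F≈ t) ⟩
      (F a + (t - a) * Q t) * G t
        ≈⟨ solve 4 (λ f x q g → (f :+ x :* q) :* g := f :* g :+ x :* (q :* g)) refl (F a) (t - a) (Q t) (G t) ⟩
      F a * G t + (t - a) * (Q t * G t)
        ≈⟨ +-congʳ (*-congˡ (G≈ t)) ⟩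
      F a * (G a + (t - a) * P t) + (t - a) * (Q t * G t)
        ≈⟨ solve 5 (λ f x q g p → f :* (g :+ x :* p) :+ x :* q := f :* g :+ x :* (q :+ f :* p))
             refl (F a) (t - a) (Q t * G t) (G a) (P t) ⟩
      F a * G a + (t - a) * (Q t * G t + F a * P t) ∎

  poly-minus : ∀ {F G} → IsPolynomial F → IsPolynomial G → IsPolynomial (λ t → F t - G t)
  poly-minus {F} {G} F-poly G-poly = poly-resp (λ t → solve 2 (λ f g → f :+ (:- :1) :* g := f :- g) refl (F t) (G t))
    (poly-+ F-poly (poly-scale (- 1#) G-poly))

  poly-sum : ∀ {n} {F : Fin n → Carrier → Carrier} → (∀ i → IsPolynomial (F i)) →
             IsPolynomial (λ t → sum (λ i → F i t))
  poly-sum {zero}  F-poly = poly-const 0#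
  poly-sum {suc n} F-poly = poly-+ (F-poly zero) (poly-sum (F-poly ∘ suc))

  -- A whole sequence of zeros replaces a bound on the degree. After division at `x 0` the quotient
  -- vanishes at the later points, whose differences from `x 0` are invertible.
  poly-vanishes : ∀ {F} → IsPolynomial F → (x : ℕ → Carrier) → (∀ {i j} → i ℕ.< j → x j # x i) →
                  (∀ i → F (x i) ≈ 0#) → ∀ t → F t ≈ 0#
  poly-vanishes (constant a F≈a) x x-apart F≈0 t = trans (F≈a t) (trans (sym (F≈a (x 0))) (F≈0 0))
  poly-vanishes {F} (divided F÷) x x-apart F≈0 t with F÷ (x 0)
  ... | Q , Q-poly , F≈ = trans (F≈ t) (trans
          (+-cong (F≈0 0) (trans (*-congˡ (poly-vanishes Q-poly (x ∘ suc) (x-apart ∘ ℕ.s≤s) Q≈0 t)) (zeroʳ (t - x 0))))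
          (+-identityˡ 0#))
    where
    Q≈0 : ∀ i → Q (x (suc i)) ≈ 0#
    Q≈0 i = cancel-# (x-apart (ℕ.s≤s ℕ.z≤n)) (begin
      (x (suc i) - x 0) * Q (x (suc i))             ≈⟨ +-identityˡ _ ⟨
      0# + (x (suc i) - x 0) * Q (x (suc i))        ≈⟨ +-congʳ (F≈0 0) ⟨
      F (x 0) + (x (suc i) - x 0) * Q (x (suc i))   ≈⟨ F≈ (x (suc i)) ⟨
      F (x (suc i))                                 ≈⟨ F≈0 (suc i) ⟩
      0#                                            ∎)

  poly-agree : ∀ {F G} → IsPolynomial F → IsPolynomial G → (x : ℕ → Carrier) → (∀ {i j} → i ℕ.< j → x j # x i) →
               (∀ i → F (x i) ≈ G (x i)) → ∀ t → F t ≈ G t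
  poly-agree F-poly G-poly x x-apart F≈G t =
    x-y≈0⇒x≈y _ _ (poly-vanishes (poly-minus F-poly G-poly) x x-apart (λ i → x≈y⇒x-y≈0 (F≈G i)) t)

  poly-agree-#0 : ∀ {F G} → IsPolynomial F → IsPolynomial G → (∀ t → t # 0# → F t ≈ G t) → ∀ t → F t ≈ G t
  poly-agree-#0 F-poly G-poly F≈G = poly-agree F-poly G-poly (ι ∘ suc) (λ i<j → ι-# (ℕ.s≤s i<j))
    (λ i → F≈G (ι (suc i)) (ι-# {0} {suc i} (ℕ.s≤s ℕ.z≤n)))

  -- The squares of the natural numbers already form an infinite sequence of points apart from each
  -- other.
  poly-agree-squares : ∀ {F G} → IsPolynomial F → IsPolynomial G → (∀ t → F (t * t) ≈ G (t * t)) → ∀ t → F t ≈ G t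
  poly-agree-squares F-poly G-poly F≈G = poly-agree F-poly G-poly (λ i → ι (i ℕ.* i))
    (λ {i} {j} i<j → ι-# {i ℕ.* i} {j ℕ.* j} (ℕ.*-mono-< i<j i<j))
    (λ i → trans (poly-cong F-poly (ι-* i i)) (trans (F≈G (ι i)) (poly-cong G-poly (sym (ι-* i i)))))

  -- Value and derivative at `0#`, without limits. The remainder is required to be polynomial, which
  -- is what determines `b`.
  Jet : (Carrier → Carrier) → Carrier → Carrier → Set (c ⊔ ℓ₁)
  Jet F a b = ∃[ G ] IsPolynomial G × (∀ s → F s ≈ a + s * (b + s * G s))

  jet-resp : ∀ {F F′ a a′ b b′} → (∀ s → F s ≈ F′ s) → a ≈ a′ → b ≈ b′ → Jet F a b → Jet F′ a′ b′
  jet-resp F≈F′ a≈a′ b≈b′ (G , G-poly , F≈) =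
    G , G-poly , λ s → trans (sym (F≈F′ s)) (trans (F≈ s) (+-cong a≈a′ (*-congˡ (+-congʳ b≈b′))))

  jet-affine : ∀ a b → Jet (λ s → a + s * b) a b
  jet-affine a b = (λ _ → 0#) , poly-const 0# ,
    solve 3 (λ a b s → a :+ s :* b := a :+ s :* (b :+ s :* :0)) refl a b

  jet-poly : ∀ {F} → IsPolynomial F → ∃[ b ] Jet F (F 0#) b
  jet-poly {F} F-poly with divide F-poly 0#
  ... | Q , Q-poly , F≈ with divide Q-poly 0#
  ...   | P , P-poly , Q≈ = Q 0# , P , P-poly , λ s → trans (F≈ s) (+-congˡ
            (trans (*-congʳ (x-0≈x s)) (*-congˡ (trans (Q≈ s) (+-congˡ (*-congʳ (x-0≈x s)))))))

  jet-+ : ∀ {F F′ a a′ b b′} → Jet F a b → Jet F′ a′ b′ → Jet (λ s → F s + F′ s) (a + a′) (b + b′)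
  jet-+ {a = a} {a′} {b} {b′} (G , G-poly , F≈) (G′ , G′-poly , F′≈) =
    (λ s → G s + G′ s) , poly-+ G-poly G′-poly , λ s → trans (+-cong (F≈ s) (F′≈ s))
      (solve 7 (λ a a′ b b′ s g g′ → a :+ s :* (b :+ s :* g) :+ (a′ :+ s :* (b′ :+ s :* g′))
                  := a :+ a′ :+ s :* (b :+ b′ :+ s :* (g :+ g′))) refl a a′ b b′ s (G s) (G′ s))

  jet-* : ∀ {F F′ a a′ b b′} → Jet F a b → Jet F′ a′ b′ → Jet (λ s → F s * F′ s) (a * a′) (a * b′ + b * a′)
  jet-* {F} {F′} {a} {a′} {b} {b′} (G , G-poly , F≈) (G′ , G′-poly , F′≈) =
    (λ s → a * G′ s + (b + s * G s) * (b′ + s * G′ s) + G s * a′) ,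
    poly-+ (poly-+ (poly-scale a G′-poly) (poly-* (tail-poly b G-poly) (tail-poly b′ G′-poly)))
           (poly-* G-poly (poly-const a′)) ,
    λ s → trans (*-cong (F≈ s) (F′≈ s))
      (solve 7 (λ a a′ b b′ s g g′ → (a :+ s :* (b :+ s :* g)) :* (a′ :+ s :* (b′ :+ s :* g′))
                  := a :* a′ :+ s :* (a :* b′ :+ b :* a′
                       :+ s :* (a :* g′ :+ (b :+ s :* g) :* (b′ :+ s :* g′) :+ g :* a′)))
         refl a a′ b b′ s (G s) (G′ s))
    where
    tail-poly : ∀ b {G} → IsPolynomial G → IsPolynomial (λ s → b + s * G s)
    tail-poly b G-poly = poly-+ (poly-const b) (poly-* poly-id G-poly)

  jet-value : ∀ {F a b} → Jet F a b → F 0# ≈ a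
  jet-value {a = a} (G , _ , F≈) = trans (F≈ 0#) (trans (+-congˡ (zeroˡ _)) (+-identityʳ a))

  -- Away from `0#` the common value can be subtracted and `s` cancelled. The two slopes are
  -- polynomial in `s`, so they agree at `0#` as well.
  jet-unique : ∀ {F a a′ b b′} → Jet F a b → Jet F a′ b′ → b ≈ b′
  jet-unique {F} {a} {a′} {b} {b′} J@(G , G-poly , F≈) J′@(G′ , G′-poly , F′≈) = begin
    b                ≈⟨ at-0 b (G 0#) ⟨
    b + 0# * G 0#    ≈⟨ poly-agree-#0 (slope b G-poly) (slope b′ G′-poly) agree 0# ⟩
    b′ + 0# * G′ 0#  ≈⟨ at-0 b′ (G′ 0#) ⟩
    b′               ∎
    where
    at-0 : ∀ b g → b + 0# * g ≈ b
    at-0 b g = solve 2 (λ b g → b :+ :0 :* g := b) refl b g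
    slope : ∀ b {G} → IsPolynomial G → IsPolynomial (λ s → b + s * G s)
    slope b G-poly = poly-+ (poly-const b) (poly-* poly-id G-poly)
    agree : ∀ s → s # 0# → b + s * G s ≈ b′ + s * G′ s
    agree s s#0 = cancelˡ-#0 s#0 (begin
      s * (b + s * G s)                  ≈⟨ solve 2 (λ a x → x := a :+ x :- a) refl a _ ⟩
      a + s * (b + s * G s) - a          ≈⟨ +-cong (trans (sym (F≈ s)) (F′≈ s))
                                                    (-‿cong (trans (sym (jet-value J)) (jet-value J′))) ⟩
      a′ + s * (b′ + s * G′ s) - a′      ≈⟨ solve 2 (λ a x → x := a :+ x :- a) refl a′ _ ⟨
      s * (b′ + s * G′ s)                ∎)

-- The homogeneous characteristic polynomial and the trace

module HomogeneousSpectrum {c ℓ₁ ℓ₂} (ℝ : RealNumbers c ℓ₁ ℓ₂) where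
  open RealNumbers ℝ using (commutativeRing; rawSemiring)
  open CommutativeRing commutativeRing hiding (zero)
  open IntegerCoefficients commutativeRing
  open Determinants commutativeRing
  open OrderedField ℝ
  open PolynomialFunctions ℝ
  open Spectrum ℝ using (IsSpectrum)
  open Determinant rawRing
  open MatrixPower rawSemiring
  open import Algebra.Properties.Semiring.Exp semiring using (_^_; ^-homo-*)
  open import Algebra.Properties.Semiring.Sum semiring
    using (sum; sum-cong-≋; ∑-distrib-+; *-distribˡ-sum)
  open import Algebra.Properties.Group +-group using () renaming (⁻¹-injective to -‿injective)
  open import Relation.Binary.Reasoning.Setoid setoid

  private variable
    n : ℕ

  affine : Carrier → Matrix Carrier n → Carrier → Matrix Carrier n
  affine a M b i j = a * M i j + b * identity i j

  trace : Matrix Carrier n → Carrier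
  trace M = sum (λ i → M i i)

  affine-⊗ : ∀ a b c d (M N : Matrix Carrier n) i j →
    (affine a M b ⊗ affine c N d) i j ≈ a * c * (M ⊗ N) i j + a * d * M i j + b * c * N i j + b * d * identity i j
  affine-⊗ a b c d M N i j = begin
    sum (λ k → (a * M i k + b * identity i k) * (c * N k j + d * identity k j))
      ≈⟨ sum-cong-≋ (λ k → solve 8 (λ a b c d m n p q → (a :* m :+ b :* p) :* (c :* n :+ d :* q)
                             := a :* c :* (m :* n) :+ p :* (b :* c :* n :+ b :* d :* q) :+ a :* d :* m :* q)
           refl a b c d (M i k) (N k j) (identity i k) (identity k j)) ⟩
    sum (λ k → a * c * (M i k * N k j) + identity i k * (b * c * N k j + b * d * identity k j) + a * d * M i k * identity k j)
      ≈⟨ ∑-distrib-+ (λ k → a * c * (M i k * N k j) + identity i k * (b * c * N k j + b * d * identity k j)) _ ⟩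
    sum (λ k → a * c * (M i k * N k j) + identity i k * (b * c * N k j + b * d * identity k j))
      + sum (λ k → a * d * M i k * identity k j)
      ≈⟨ +-cong (∑-distrib-+ (λ k → a * c * (M i k * N k j)) _) (sum-identityʳ j (λ k → a * d * M i k)) ⟩
    sum (λ k → a * c * (M i k * N k j)) + sum (λ k → identity i k * (b * c * N k j + b * d * identity k j)) + a * d * M i j
      ≈⟨ +-congʳ (+-cong (sym (*-distribˡ-sum (a * c) (λ k → M i k * N k j)))
                         (sum-identityˡ i (λ k → b * c * N k j + b * d * identity k j))) ⟩
    a * c * (M ⊗ N) i j + (b * c * N i j + b * d * identity i j) + a * d * M i j
      ≈⟨ solve 4 (λ x y z w → x :+ (y :+ z) :+ w := x :+ w :+ y :+ z) refl _ _ _ _ ⟩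
    a * c * (M ⊗ N) i j + a * d * M i j + b * c * N i j + b * d * identity i j ∎

  pencil : Carrier → Carrier → Matrix Carrier n → Matrix Carrier n
  pencil s t M i j = t * identity i j - s * M i j

  -- The list stays fixed while `h` varies, so the spectra of polynomials in `M` are all indexed by
  -- the eigenvalues of `M`, and a splitting of that list serves for each of them.
  rootProduct : (Carrier → Carrier) → List Carrier → Carrier → Carrier → Carrier
  rootProduct h σ s t = foldr (λ x p → (t - s * h x) * p) 1# σ

  -- The multiset h(σ) is the spectrum of M, in homogeneous form.
  record HasSpectrum (M : Matrix Carrier n) (h : Carrier → Carrier) (σ : List Carrier) : Set (c ⊔ ℓ₁) where
    constructor hasSpectrum
    field
      det-pencil : ∀ s t → det (pencil s t M) ≈ rootProduct h σ s t

  rootProduct-cong : ∀ {h h′ s s′ t t′} σ → (∀ x → t - s * h x ≈ t′ - s′ * h′ x) →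
                     rootProduct h σ s t ≈ rootProduct h′ σ s′ t′
  rootProduct-cong []      eq = refl
  rootProduct-cong (x ∷ σ) eq = *-cong (eq x) (rootProduct-cong σ eq)

  rootProduct-* : ∀ {h h₁ h₂ s s₁ s₂ t t₁ t₂} σ → (∀ x → (t₁ - s₁ * h₁ x) * (t₂ - s₂ * h₂ x) ≈ t - s * h x) →
                  rootProduct h₁ σ s₁ t₁ * rootProduct h₂ σ s₂ t₂ ≈ rootProduct h σ s t
  rootProduct-* []      eq = *-identityˡ 1#
  rootProduct-* (x ∷ σ) eq = trans
    (solve 4 (λ a b c d → a :* b :* (c :* d) := a :* c :* (b :* d)) refl _ _ _ _)
    (*-cong (eq x) (rootProduct-* σ eq))

  rootProduct-scale : ∀ {h} r s t σ → rootProduct h σ (r * s) (r * t) ≈ r ^ length σ * rootProduct h σ s t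
  rootProduct-scale     r s t []      = sym (*-identityˡ 1#)
  rootProduct-scale {h} r s t (x ∷ σ) = trans (*-congˡ (rootProduct-scale r s t σ))
    (solve 6 (λ r s t x y p → (r :* t :- r :* s :* x) :* (y :* p) := r :* y :* ((t :- s :* x) :* p))
       refl r s t (h x) (r ^ length σ) (rootProduct h σ s t))

  det-scale : ∀ r (M : Matrix Carrier n) → det (λ i j → r * M i j) ≈ r ^ n * det M
  det-scale {zero}  r M = sym (*-identityˡ 1#)
  det-scale {suc n} r M = trans
    (sum-cong-≋ (λ j → trans (*-congˡ {sign j * (r * M zero j)} (det-scale r (λ i k → M (suc i) (punchIn j k))))
      (solve 5 (λ s r m y d → s :* (r :* m) :* (y :* d) := r :* y :* (s :* m :* d))
         refl (sign j) r (M zero j) (r ^ n) (det (λ i k → M (suc i) (punchIn j k))))))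
    (sym (*-distribˡ-sum (r ^ suc n) (λ j → sign j * M zero j * det (λ i k → M (suc i) (punchIn j k)))))

  poly-det : {M : Carrier → Matrix Carrier n} → (∀ i j → IsPolynomial (λ s → M s i j)) → IsPolynomial (λ s → det (M s))
  poly-det {zero}  M-poly = poly-const 1#
  poly-det {suc n} M-poly = poly-sum (λ j → poly-* (poly-scale (sign j) (M-poly zero j))
                                                   (poly-det (λ i k → M-poly (suc i) (punchIn j k))))

  poly-det-pencilˢ : ∀ (M : Matrix Carrier n) t → IsPolynomial (λ s → det (pencil s t M))
  poly-det-pencilˢ M t = poly-det {M = λ s → pencil s t M}
    (λ i j → poly-minus (poly-const (t * identity i j)) (poly-* poly-id (poly-const (M i j))))

  poly-det-pencilᵗ : ∀ (M : Matrix Carrier n) s → IsPolynomial (λ t → det (pencil s t M))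
  poly-det-pencilᵗ M s = poly-det {M = λ t → pencil s t M}
    (λ i j → poly-minus (poly-* poly-id (poly-const (identity i j))) (poly-const (s * M i j)))

  poly-rootProductˢ : ∀ h σ t → IsPolynomial (λ s → rootProduct h σ s t)
  poly-rootProductˢ h []      t = poly-const 1#
  poly-rootProductˢ h (x ∷ σ) t =
    poly-* (poly-minus (poly-const t) (poly-* poly-id (poly-const (h x)))) (poly-rootProductˢ h σ t)

  poly-rootProductᵗ : ∀ h σ s → IsPolynomial (λ t → rootProduct h σ s t)
  poly-rootProductᵗ h []      s = poly-const 1#
  poly-rootProductᵗ h (x ∷ σ) s = poly-* (poly-minus poly-id (poly-const _)) (poly-rootProductᵗ h σ s)

  -- Away from 0 the two homogeneous polynomials agree up to the powers of s
  -- given by their degrees, and comparing values at s = 0 equates the degrees.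
  isSpectrum⇒hasSpectrum : {M : Matrix Carrier n} {σ : List Carrier} → IsSpectrum M σ → HasSpectrum M id σ
  isSpectrum⇒hasSpectrum {n} {M} {σ} spec = hasSpectrum (λ s t → homogeneous t s)
    where
    ℓ : ℕ
    ℓ = length σ
    Φ Ψ : Carrier → Carrier → Carrier
    Φ t s = det (pencil s t M)
    Ψ t s = rootProduct id σ s t

    monic : ∀ t → det (pencil 1# t M) ≈ rootProduct id σ 1# t
    monic t = trans (det-cong (λ i j → +-congˡ (-‿cong (*-identityˡ (M i j)))))
      (trans (spec t) (fold σ))
      where
      fold : ∀ σ → foldr (λ x p → (t + - x) * p) 1# σ ≈ rootProduct id σ 1# t
      fold []      = refl
      fold (x ∷ σ) = *-cong (+-congˡ (-‿cong (sym (*-identityˡ x)))) (fold σ)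

    -- The monic identity at `u = t / s`, with denominators cleared: the determinant is homogeneous
    -- of degree `n`, the product of degree `ℓ`.
    away : ∀ t s → s # 0# → s ^ ℓ * Φ t s ≈ s ^ n * Ψ t s
    away t s s#0 with #⇒invertible s#0
    ... | s⁻¹ , _ , s*s⁻¹≈1 = begin
      s ^ ℓ * Φ t s
        ≈⟨ *-congˡ (det-cong (λ i j → trans (+-cong (*-congʳ (sym s*u≈t)) refl)
             (solve 4 (λ s u i m → s :* u :* i :- s :* m := s :* (u :* i :- :1 :* m)) refl s u (identity i j) (M i j)))) ⟩
      s ^ ℓ * det (λ i j → s * pencil 1# u M i j)      ≈⟨ *-congˡ (trans (det-scale s (pencil 1# u M)) (*-congˡ (monic u))) ⟩
      s ^ ℓ * (s ^ n * rootProduct id σ 1# u)          ≈⟨ solve 3 (λ a b c → a :* (b :* c) := b :* (a :* c)) refl _ _ _ ⟩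
      s ^ n * (s ^ ℓ * rootProduct id σ 1# u)          ≈⟨ *-congˡ (rootProduct-scale s 1# u σ) ⟨
      s ^ n * rootProduct id σ (s * 1#) (s * u)
        ≈⟨ *-congˡ (rootProduct-cong σ (λ x → +-cong s*u≈t (-‿cong (*-congʳ (*-identityʳ s))))) ⟩
      s ^ n * Ψ t s ∎
      where
      u : Carrier
      u = t * s⁻¹
      s*u≈t : s * u ≈ t
      s*u≈t = begin
        s * (t * s⁻¹)           ≈⟨ solve 3 (λ s t r → s :* (t :* r) := t :* ((s :- :0) :* r)) refl s t s⁻¹ ⟩
        t * ((s - 0#) * s⁻¹)    ≈⟨ *-congˡ s*s⁻¹≈1 ⟩
        t * 1#                  ≈⟨ *-identityʳ t ⟩
        t                       ∎

    Φ₀≈1 : Φ 1# 0# ≈ 1#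
    Φ₀≈1 = trans (det-cong {N = identity} (λ i j → solve 2 (λ i m → :1 :* i :- :0 :* m := i) refl (identity i j) (M i j)))
      (det-identity {n})
      where
      det-identity : ∀ {n} → det (identity {n}) ≈ 1#
      det-identity {zero}  = refl
      det-identity {suc n} = begin
        1# * 1# * det (identity {n}) + sum (λ j → - sign j * 0# * minor j)
          ≈⟨ +-cong (*-cong (*-identityˡ 1#) (det-identity {n}))
               (sum-zero _ (λ j → trans (*-congʳ {minor j} (zeroʳ (- sign j))) (zeroˡ (minor j)))) ⟩
        1# * 1# + 0#   ≈⟨ trans (+-identityʳ _) (*-identityˡ 1#) ⟩
        1#             ∎
        where
        minor : Fin n → Carrier
        minor j = det (λ i k → identity (suc i) (punchIn (suc j) k))

    Ψ₀≈1 : Ψ 1# 0# ≈ 1#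
    Ψ₀≈1 = at-0 σ
      where
      at-0 : ∀ σ → rootProduct id σ 0# 1# ≈ 1#
      at-0 []      = refl
      at-0 (x ∷ σ) = trans (*-cong (solve 1 (λ x → :1 :- :0 :* x := :1) refl x) (at-0 σ)) (*-identityˡ 1#)

    poly-^ : ∀ k → IsPolynomial (λ s → s ^ k)
    poly-^ zero    = poly-const 1#
    poly-^ (suc k) = poly-* poly-id (poly-^ k)

    -- Cancelling `s ^ k` leaves `F` divisible by `s`, at first away from `0#` and then everywhere,
    -- which contradicts its value at `0#`.
    not-< : ∀ {F G : Carrier → Carrier} {k m} → IsPolynomial F → IsPolynomial G → F 0# ≈ 1# →
            (∀ s → s # 0# → s ^ k * F s ≈ s ^ m * G s) → ¬ k ℕ.< m
    not-< {F} {G} {k} F-poly G-poly F₀≈1 eq k<m with ℕ.m≤n⇒∃[o]m+o≡n k<m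
    ... | o , ≡.refl = #-irrefl 1≈0 1#0
      where
      1≈0 : 1# ≈ 0#
      1≈0 = begin
        1#                     ≈⟨ F₀≈1 ⟨
        F 0#                   ≈⟨ poly-agree-#0 F-poly (poly-* poly-id (poly-* (poly-^ o) G-poly))
                                    (λ s s#0 → cancelˡ-#0 (^-#0 k s#0) (trans (eq s s#0) (trans
                                      (*-congʳ (*-congˡ (^-homo-* s k o)))
                                      (solve 4 (λ s x y g → s :* (x :* y) :* g := x :* (s :* (y :* g)))
                                         refl s (s ^ k) (s ^ o) (G s))))) 0# ⟩
        0# * (0# ^ o * G 0#)   ≈⟨ zeroˡ _ ⟩
        0#                     ∎

    ℓ≡n : ℓ ≡ n
    ℓ≡n with ℕ.<-cmp ℓ n
    ... | tri< ℓ<n _ _ = ⊥-elim (not-< (poly-det-pencilˢ M 1#) (poly-rootProductˢ id σ 1#) Φ₀≈1 (away 1#) ℓ<n)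
    ... | tri≈ _ ℓ≡n _ = ℓ≡n
    ... | tri> _ _ n<ℓ = ⊥-elim (not-< (poly-rootProductˢ id σ 1#) (poly-det-pencilˢ M 1#) Ψ₀≈1
                                  (λ s s#0 → sym (away 1# s s#0)) n<ℓ)

    homogeneous : ∀ t s → Φ t s ≈ Ψ t s
    homogeneous t = poly-agree-#0 (poly-det-pencilˢ M t) (poly-rootProductˢ id σ t)
      (λ s s#0 → cancelˡ-#0 (^-#0 n s#0)
        (≡.subst (λ k → s ^ k * Φ t s ≈ s ^ n * Ψ t s) ℓ≡n (away t s s#0)))

  -- The pencil of `a M + b I` at `(s, t)` is the pencil of `M` at `(s a, t − s b)`. Homogeneity
  -- makes this a mere substitution, also when `a` is not invertible.
  hasSpectrum-affine : ∀ {M : Matrix Carrier n} {h σ} a b → HasSpectrum M h σ →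
                       HasSpectrum (affine a M b) (λ x → a * h x + b) σ
  hasSpectrum-affine {M = M} {h} {σ} a b (hasSpectrum spec) = hasSpectrum λ s t → begin
    det (pencil s t (affine a M b))
      ≈⟨ det-cong (λ i j → solve 6 (λ s t a b m i → t :* i :- s :* (a :* m :+ b :* i) := (t :- s :* b) :* i :- s :* a :* m)
           refl s t a b (M i j) (identity i j)) ⟩
    det (pencil (s * a) (t - s * b) M)
      ≈⟨ spec (s * a) (t - s * b) ⟩
    rootProduct h σ (s * a) (t - s * b)
      ≈⟨ rootProduct-cong σ (λ x → solve 5 (λ s t a b x → t :- s :* b :- s :* a :* x := t :- s :* (a :* x :+ b))
           refl s t a b (h x)) ⟩
    rootProduct (λ x → a * h x + b) σ s t ∎

  -- The factorisation into pencils at `s` and `- s` reaches only square arguments. Both sides are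
  -- polynomial in each variable separately, so these arguments determine them.
  hasSpectrum-square : ∀ {M : Matrix Carrier n} {h σ} → HasSpectrum M h σ → HasSpectrum (M ⊗ M) (λ x → h x * h x) σ
  hasSpectrum-square {n} {M} {h} {σ} (hasSpectrum spec) = hasSpectrum λ s t →
    poly-agree-squares (poly-det-pencilˢ (M ⊗ M) t) (poly-rootProductˢ (λ x → h x * h x) σ t)
      (λ s → poly-agree-squares (poly-det-pencilᵗ (M ⊗ M) (s * s)) (poly-rootProductᵗ (λ x → h x * h x) σ (s * s))
        (λ t → at-squares s t) t) s
    where
    at-squares : ∀ s t → det (pencil (s * s) (t * t) (M ⊗ M)) ≈ rootProduct (λ x → h x * h x) σ (s * s) (t * t)
    at-squares s t = begin
      det (pencil (s * s) (t * t) (M ⊗ M))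
        ≈⟨ det-cong (λ i j → trans
             (solve 5 (λ s t q m i → t :* t :* i :- s :* s :* q
                  := (:- s) :* (:- (:- s)) :* q :+ (:- s) :* t :* m :+ t :* (:- (:- s)) :* m :+ t :* t :* i)
                refl s t ((M ⊗ M) i j) (M i j) (identity i j))
             (sym (affine-⊗ (- s) t (- (- s)) t M M i j))) ⟩
      -- The double negation gives both factors the same shape, so that `pencil-spec` applies at `s`
      -- and at `- s`.
      det (affine (- s) M t ⊗ affine (- (- s)) M t)
        ≈⟨ det-⊗ (affine (- s) M t) (affine (- (- s)) M t) ⟩
      det (affine (- s) M t) * det (affine (- (- s)) M t)
        ≈⟨ *-cong (pencil-spec s) (pencil-spec (- s)) ⟩
      rootProduct h σ s t * rootProduct h σ (- s) t
        ≈⟨ rootProduct-* σ (λ x → solve 3 (λ s t x → (t :- s :* x) :* (t :- (:- s) :* x) := t :* t :- s :* s :* (x :* x))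
             refl s t (h x)) ⟩
      rootProduct (λ x → h x * h x) σ (s * s) (t * t) ∎
      where
      pencil-spec : ∀ s → det (affine (- s) M t) ≈ rootProduct h σ s t
      pencil-spec s = trans (det-cong (λ i j → solve 4 (λ s t m i → (:- s) :* m :+ t :* i := t :* i :- s :* m)
        refl s t (M i j) (identity i j))) (spec s t)

  -- Meant for `jet-det`: at `s = 0#` the pencil is the identity matrix, and deleting its row zero
  -- and a later column leaves column zero full of zeros.
  det-zero-column : (M : Matrix Carrier (suc n)) → (∀ i → M i zero ≈ 0#) → det M ≈ 0#
  det-zero-column {n} M column = sum-zero (λ j → sign j * M zero j * minor j)
    λ { zero    → trans (*-congʳ {minor zero} (trans (*-congˡ (column zero)) (zeroʳ 1#))) (zeroˡ (minor zero))
      ; (suc j) → trans (*-congˡ {sign (suc j) * M zero (suc j)} (minor-zero n M column j)) (zeroʳ _) }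
    where
    minor : Fin (suc n) → Carrier
    minor j = det (λ i k → M (suc i) (punchIn j k))
    minor-zero : ∀ n (M : Matrix Carrier (suc n)) → (∀ i → M i zero ≈ 0#) → ∀ j →
                 det {n} (λ i k → M (suc i) (punchIn (suc j) k)) ≈ 0#
    minor-zero (suc n) M column j = det-zero-column (λ i k → M (suc i) (punchIn (suc j) k)) (λ i → column (suc i))

  jet-sum : ∀ {n} {F : Fin n → Carrier → Carrier} {a b : Fin n → Carrier} → (∀ i → Jet (F i) (a i) (b i)) →
            Jet (λ s → sum (λ i → F i s)) (sum a) (sum b)
  jet-sum {zero}  J = jet-resp (λ s → trans (+-identityˡ _) (zeroʳ s)) refl refl (jet-affine 0# 0#)
  jet-sum {suc n} J = jet-+ (J zero) (jet-sum (J ∘ suc))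

  -- In the expansion along row zero the first term is `1 − s M₀₀` times a smaller pencil. Any other
  -- term has an entry divisible by `s` and a minor that vanishes at `s = 0#`, so it is of second
  -- order.
  jet-det : ∀ (M : Matrix Carrier n) → Jet (λ s → det (pencil s 1# M)) 1# (- trace M)
  jet-det {zero}  M = jet-resp (λ s → solve 1 (λ s → :1 :+ s :* (:- :0) := :1) refl s) refl refl (jet-affine 1# (- 0#))
  jet-det {suc n} M = jet-resp (λ s → refl)
    (trans (+-congˡ {1# * 1#} (sum-zero {n} (λ _ → 0#) (λ _ → refl)))
      (trans (+-identityʳ _) (*-identityˡ 1#)))
    (trans (+-congˡ (sum-zero {n} (λ _ → 0#) (λ _ → refl)))
      (solve 2 (λ m t → :1 :* (:- t) :+ (:- m) :* :1 :+ :0 := :- (m :+ t)) refl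
         (M zero zero) (trace (λ i j → M (suc i) (suc j)))))
    (jet-+ (jet-* (jet-resp (λ s → solve 2 (λ s m → :1 :+ s :* (:- m) := :1 :* (:1 :* :1 :- s :* m)) refl s (M zero zero))
                            refl refl (jet-affine 1# (- M zero zero)))
                  (jet-det (λ i j → M (suc i) (suc j))))
           (jet-sum (λ j → off-diagonal n M j)))
    where
    off-diagonal : ∀ n (M : Matrix Carrier (suc n)) (j : Fin n) →
      Jet (λ s → sign (suc j) * pencil s 1# M zero (suc j) * det (λ i k → pencil s 1# M (suc i) (punchIn (suc j) k))) 0# 0#
    off-diagonal (suc n) M j =
      -- The slope `b` of the minor is multiplied by the value `0#` of the entry, so its existence
      -- suffices.
      let (b , minor-jet) = jet-poly (poly-det {M = minor} (λ i k → poly-minus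
            (poly-const (1# * identity (suc i) (punchIn (suc j) k)))
            (poly-* poly-id (poly-const (M (suc i) (punchIn (suc j) k)))))) in
      jet-resp (λ s → refl) (zeroˡ _)
        (trans (+-cong (zeroˡ b) (*-congˡ (det-zero-column (minor 0#) (λ i →
           solve 1 (λ m → :1 :* :0 :- :0 :* m := :0) refl (M (suc i) zero))))) (trans (+-identityˡ _) (zeroʳ _)))
        (jet-* (jet-resp (λ s → solve 3 (λ s x m → :0 :+ s :* ((:- x) :* (:- m)) := (:- x) :* (:1 :* :0 :- s :* m))
                            refl s (sign j) (M zero (suc j)))
                         refl refl (jet-affine 0# (- sign j * - M zero (suc j))))
               minor-jet)
      where
      minor : Carrier → Matrix Carrier (suc n)
      minor s i k = pencil s 1# M (suc i) (punchIn (suc j) k)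

  jet-rootProduct : ∀ h σ → Jet (λ s → rootProduct h σ s 1#) 1# (- foldr (λ x p → h x + p) 0# σ)
  jet-rootProduct h []      = jet-resp (λ s → solve 1 (λ s → :1 :+ s :* (:- :0) := :1) refl s) refl refl (jet-affine 1# (- 0#))
  jet-rootProduct h (x ∷ σ) = jet-resp (λ s → refl) (*-identityˡ 1#)
    (solve 2 (λ x p → :1 :* (:- p) :+ (:- x) :* :1 := :- (x :+ p)) refl (h x) (foldr (λ x p → h x + p) 0# σ))
    (jet-* (jet-resp (λ s → solve 2 (λ s x → :1 :+ s :* (:- x) := :1 :- s :* x) refl s (h x)) refl refl (jet-affine 1# (- h x)))
           (jet-rootProduct h σ))

  trace-hasSpectrum : ∀ {M : Matrix Carrier n} {h σ} → HasSpectrum M h σ → trace M ≈ foldr (λ x p → h x + p) 0# σ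
  trace-hasSpectrum {M = M} {h} {σ} (hasSpectrum spec) = -‿injective (jet-unique (jet-det M)
    (jet-resp (λ s → sym (spec s 1#)) refl refl (jet-rootProduct h σ)))

-- Matrices on a fibred index set, rigidity and the powers of a covering matrix

module QuotientMatrices {c ℓ₁ ℓ₂} (ℝ : RealNumbers c ℓ₁ ℓ₂) (n r : ℕ) where
  open RealNumbers ℝ using (commutativeRing; rawSemiring)
  open CommutativeRing commutativeRing hiding (zero)
  open IntegerCoefficients commutativeRing
  open Determinants commutativeRing
    using (sum-identityˡ; sum-identityʳ; identity-symmetric; identity-diagonal)
  open OrderedField ℝ
  open HomogeneousSpectrum ℝ using (affine; trace)
  open MatrixPower rawSemiring
  open import Algebra.Properties.Semiring.Exp semiring using (_^_)
  open import Algebra.Properties.Semiring.Mult semiring using (×-assoc-*; ×-congʳ)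
  open import Algebra.Properties.Semiring.Sum semiring
    using (sum; sum-cong-≋; sum-replicate; ∑-distrib-+; ∑-comm; *-distribˡ-sum; *-distribʳ-sum)
  open import Relation.Binary.Reasoning.Setoid setoid

  sum-↑ : ∀ m {k} (f : Vector Carrier (m ℕ.+ k)) → sum f ≈ sum (f ∘ (_↑ˡ k)) + sum (f ∘ (m ↑ʳ_))
  sum-↑ zero    f = sym (+-identityˡ _)
  sum-↑ (suc m) f = trans (+-congˡ (sum-↑ m (f ∘ suc))) (sym (+-assoc _ _ _))

  sum-combine : ∀ m {k} (f : Vector Carrier (m ℕ.* k)) → sum f ≈ sum (λ u → sum (λ j → f (combine {m} {k} u j)))
  sum-combine zero        f = refl
  sum-combine (suc m) {k} f = trans (sum-↑ k f) (+-congˡ (sum-combine m (f ∘ (k ↑ʳ_))))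

  sum-const : ∀ k a → sum {k} (λ _ → a) ≈ ι k * a
  sum-const k a = trans (sum-replicate k) (sym (trans (×-assoc-* k 1# a) (×-congʳ k (*-identityˡ a))))

  π : Fin (n ℕ.* r) → Fin n
  π = quotient {n} r

  pair : Fin n → Fin r → Fin (n ℕ.* r)
  pair = combine

  π-pair : ∀ u j → π (pair u j) ≡ u
  π-pair u j = ≡.cong proj₁ (Fin.remQuot-combine u j)

  sum-π : (g : Vector Carrier n) → sum (g ∘ π) ≈ ι r * sum g
  sum-π g = begin
    sum (g ∘ π)                                      ≈⟨ sum-combine n (g ∘ π) ⟩
    sum (λ u → sum {r} (λ j → g (π (pair u j))))
      ≈⟨ sum-cong-≋ (λ u → trans (sum-cong-≋ (λ j → reflexive (≡.cong g (π-pair u j)))) (sum-const r (g u))) ⟩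
    sum (λ u → ι r * g u)                            ≈⟨ *-distribˡ-sum (ι r) g ⟨
    ι r * sum g                                      ∎

  -- X acts as Y on vectors that are constant on the fibres of π.
  Covers : Matrix Carrier (n ℕ.* r) → Matrix Carrier n → Set ℓ₁
  Covers X Y = ∀ x u → sum (λ j → X x (pair u j)) ≈ Y (π x) u

  covers-sum : ∀ {X Y} → Covers X Y → ∀ x w → sum (λ y → X x y * w (π y)) ≈ sum (λ u → Y (π x) u * w u)
  covers-sum {X} {Y} cov x w = trans (sum-combine n (λ y → X x y * w (π y))) (sum-cong-≋ (λ u → begin
    sum (λ j → X x (pair u j) * w (π (pair u j)))
      ≈⟨ sum-cong-≋ (λ j → *-congˡ {X x (pair u j)} (reflexive (≡.cong w (π-pair u j)))) ⟩
    sum (λ j → X x (pair u j) * w u)        ≈⟨ *-distribʳ-sum (w u) (λ j → X x (pair u j)) ⟨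
    sum (λ j → X x (pair u j)) * w u        ≈⟨ *-congʳ (cov x u) ⟩
    Y (π x) u * w u                            ∎))

  covers-identity : Covers identity identity
  covers-identity x u = begin
    sum (λ j → identity x (pair u j))
      -- Inserting the indicator of the fibre over `u` extends the sum to all indices, where the
      -- identity matrix evaluates it.
      ≈⟨ sum-identityʳ u (λ v → sum (λ j → identity x (pair v j))) ⟨
    sum (λ v → sum (λ j → identity x (pair v j)) * identity v u)
      ≈⟨ sum-cong-≋ (λ v → trans (*-distribʳ-sum (identity v u) (λ j → identity x (pair v j)))
           (sum-cong-≋ (λ j → *-congˡ {identity x (pair v j)}
             (reflexive (≡.cong (λ w → identity w u) (≡.sym (π-pair v j))))))) ⟩
    sum (λ v → sum (λ j → identity x (pair v j) * identity (π (pair v j)) u))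
      ≈⟨ sum-combine n (λ y → identity x y * identity (π y) u) ⟨
    sum (λ y → identity x y * identity (π y) u)
      ≈⟨ sum-identityˡ x (λ y → identity (π y) u) ⟩
    identity (π x) u ∎

  covers-affine : ∀ {X Y} a b → Covers X Y → Covers (affine a X b) (affine a Y b)
  covers-affine {X} {Y} a b cov x u = begin
    sum (λ j → a * X x (pair u j) + b * identity x (pair u j))
      ≈⟨ ∑-distrib-+ (λ j → a * X x (pair u j)) (λ j → b * identity x (pair u j)) ⟩
    sum (λ j → a * X x (pair u j)) + sum (λ j → b * identity x (pair u j))
      ≈⟨ +-cong (*-distribˡ-sum a (λ j → X x (pair u j))) (*-distribˡ-sum b (λ j → identity x (pair u j))) ⟨
    a * sum (λ j → X x (pair u j)) + b * sum (λ j → identity x (pair u j))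
      ≈⟨ +-cong (*-congˡ (cov x u)) (*-congˡ (covers-identity x u)) ⟩
    affine a Y b (π x) u ∎

  covers-⊗ : ∀ {X X′ Y Y′} → Covers X Y → Covers X′ Y′ → Covers (X ⊗ X′) (Y ⊗ Y′)
  covers-⊗ {X} {X′} {Y} {Y′} cov cov′ x u = begin
    sum (λ j → sum (λ y → X x y * X′ y (pair u j)))
      ≈⟨ ∑-comm (λ j y → X x y * X′ y (pair u j)) ⟩
    sum (λ y → sum (λ j → X x y * X′ y (pair u j)))
      ≈⟨ sum-cong-≋ (λ y → trans (sym (*-distribˡ-sum (X x y) (λ j → X′ y (pair u j)))) (*-congˡ {X x y} (cov′ y u))) ⟩
    sum (λ y → X x y * Y′ (π y) u)
      ≈⟨ covers-sum {X} {Y} cov x (λ v → Y′ v u) ⟩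
    (Y ⊗ Y′) (π x) u ∎

  Symmetricᴹ : ∀ {k} → Matrix Carrier k → Set ℓ₁
  Symmetricᴹ M = ∀ i j → M i j ≈ M j i

  symmetric-affine : ∀ {k} {M : Matrix Carrier k} a b → Symmetricᴹ M → Symmetricᴹ (affine a M b)
  symmetric-affine a b M-sym i j = +-cong (*-congˡ (M-sym i j)) (*-congˡ (reflexive (identity-symmetric i j)))

  symmetric-square : ∀ {k} {M : Matrix Carrier k} → Symmetricᴹ M → Symmetricᴹ (M ⊗ M)
  symmetric-square {M = M} M-sym i j = sum-cong-≋ (λ k → trans (*-comm (M i k) (M k j)) (*-cong (M-sym k j) (M-sym i k)))

  trace-square : ∀ {k} {M : Matrix Carrier k} → Symmetricᴹ M → trace (M ⊗ M) ≈ sum (λ i → sum (λ j → M i j * M i j))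
  trace-square {M = M} M-sym = sum-cong-≋ (λ i → sum-cong-≋ (λ j → *-congˡ {M i j} (M-sym j i)))

  -- ∑ (r X[x,y] − Y[πx,πy])² = r² (tr X² − tr Y²) when X covers Y.
  covers-rigid : ∀ {X Y} → Symmetricᴹ X → Symmetricᴹ Y → Covers X Y → trace (X ⊗ X) ≈ trace (Y ⊗ Y) →
                 ∀ x y → ι r * X x y ≈ Y (π x) (π y)
  covers-rigid {X} {Y} X-sym Y-sym cov trX≈trY x y = trans
    (solve 2 (λ a b → a := (a :- b) :+ b) refl (ι r * X x y) (Y (π x) (π y)))
    (trans (+-congʳ (square-zero (sum-nonnegative-zero (λ y → D x y * D x y) (λ y → square-nonnegative (D x y))
       (sum-nonnegative-zero (λ x → sum (λ y → D x y * D x y))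
         (λ x → sum-nonnegative (λ y → D x y * D x y) (λ y → square-nonnegative (D x y))) total x) y)))
      (+-identityˡ _))
    where
    D : Fin (n ℕ.* r) → Fin (n ℕ.* r) → Carrier
    D x y = ι r * X x y - Y (π x) (π y)
    X² : Vector Carrier (n ℕ.* r)
    X² x = sum (λ y → X x y * X x y)
    Y² : Vector Carrier n
    Y² v = sum (λ u → Y v u * Y v u)

    -- The cross term pairs row `x` of `X` with a function of `π y`, so `covers-sum` turns it into
    -- `- 2 r` times `Y² (π x)`; the last square contributes `r` times the same quantity.
    row : ∀ x → sum (λ y → D x y * D x y) ≈ ι r * ι r * X² x + - ι r * Y² (π x)
    row x = begin
      sum (λ y → D x y * D x y)
        ≈⟨ sum-cong-≋ (λ y → solve 3 (λ ρ a b → (ρ :* a :- b) :* (ρ :* a :- b)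
             := ρ :* ρ :* (a :* a) :+ a :* ((:- (ρ :+ ρ)) :* b) :+ b :* b) refl (ι r) (X x y) (Y (π x) (π y))) ⟩
      sum (λ y → ι r * ι r * (X x y * X x y) + X x y * (- (ι r + ι r) * Y (π x) (π y)) + Y (π x) (π y) * Y (π x) (π y))
        ≈⟨ ∑-distrib-+ (λ y → ι r * ι r * (X x y * X x y) + X x y * (- (ι r + ι r) * Y (π x) (π y)))
                       (λ y → Y (π x) (π y) * Y (π x) (π y)) ⟩
      sum (λ y → ι r * ι r * (X x y * X x y) + X x y * (- (ι r + ι r) * Y (π x) (π y)))
        + sum (λ y → Y (π x) (π y) * Y (π x) (π y))
        ≈⟨ +-cong (∑-distrib-+ (λ y → ι r * ι r * (X x y * X x y)) (λ y → X x y * (- (ι r + ι r) * Y (π x) (π y))))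
                  (sum-π (λ v → Y (π x) v * Y (π x) v)) ⟩
      sum (λ y → ι r * ι r * (X x y * X x y)) + sum (λ y → X x y * (- (ι r + ι r) * Y (π x) (π y))) + ι r * Y² (π x)
        ≈⟨ +-congʳ (+-cong (sym (*-distribˡ-sum (ι r * ι r) (λ y → X x y * X x y)))
             (trans (covers-sum {X} {Y} cov x (λ v → - (ι r + ι r) * Y (π x) v)) (trans
               (sum-cong-≋ (λ u → solve 2 (λ a b → a :* (b :* a) := b :* (a :* a)) refl (Y (π x) u) (- (ι r + ι r))))
               (sym (*-distribˡ-sum (- (ι r + ι r)) (λ u → Y (π x) u * Y (π x) u)))))) ⟩
      ι r * ι r * X² x + - (ι r + ι r) * Y² (π x) + ι r * Y² (π x)
        ≈⟨ solve 3 (λ ρ a b → ρ :* ρ :* a :+ (:- (ρ :+ ρ)) :* b :+ ρ :* b := ρ :* ρ :* a :+ (:- ρ) :* b)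
             refl (ι r) (X² x) (Y² (π x)) ⟩
      ι r * ι r * X² x + - ι r * Y² (π x) ∎

    total : sum (λ x → sum (λ y → D x y * D x y)) ≈ 0#
    total = begin
      sum (λ x → sum (λ y → D x y * D x y))
        ≈⟨ sum-cong-≋ row ⟩
      sum (λ x → ι r * ι r * X² x + - ι r * Y² (π x))
        ≈⟨ ∑-distrib-+ (λ x → ι r * ι r * X² x) (λ x → - ι r * Y² (π x)) ⟩
      sum (λ x → ι r * ι r * X² x) + sum (λ x → - ι r * Y² (π x))
        ≈⟨ +-cong (*-distribˡ-sum (ι r * ι r) X²) (*-distribˡ-sum (- ι r) (Y² ∘ π)) ⟨
      ι r * ι r * sum X² + - ι r * sum (Y² ∘ π)
        ≈⟨ +-cong (*-congˡ (trans (sym (trace-square X-sym)) (trans trX≈trY (trace-square Y-sym)))) (*-congˡ (sum-π Y²)) ⟩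
      ι r * ι r * sum Y² + - ι r * (ι r * sum Y²)
        ≈⟨ solve 2 (λ ρ s → ρ :* ρ :* s :+ (:- ρ) :* (ρ :* s) := :0) refl (ι r) (sum Y²) ⟩
      0# ∎

  -- `Y` to the power `m`, applied to `Z`, with the factors accumulated on the argument: multiplying
  -- `Z` by `Y` is then a shift of `m` by computation, without associativity of `_⊗_`.
  iterate : Matrix Carrier n → ℕ → Matrix Carrier n → Matrix Carrier n
  iterate Y zero    Z = Z
  iterate Y (suc m) Z = iterate Y m (Y ⊗ Z)

  -- The linear span of the powers of a walk-regular Y has this property.
  ConstantDiagonals : Matrix Carrier n → Matrix Carrier n → Set ℓ₁
  ConstantDiagonals Y Z = ∀ m i j → iterate Y m Z i i ≈ iterate Y m Z j j

  module _ {Y : Matrix Carrier n} where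

    iterate-linear : ∀ m {Z Z₁ Z₂} a b → (∀ i j → Z i j ≈ a * Z₁ i j + b * Z₂ i j) →
                     ∀ i j → iterate Y m Z i j ≈ a * iterate Y m Z₁ i j + b * iterate Y m Z₂ i j
    iterate-linear zero                a b eq = eq
    iterate-linear (suc m) {Z} {Z₁} {Z₂} a b eq = iterate-linear m a b λ i j → begin
      sum (λ k → Y i k * Z k j)
        ≈⟨ sum-cong-≋ (λ k → trans (*-congˡ {Y i k} (eq k j))
             (solve 5 (λ a b y z w → y :* (a :* z :+ b :* w) := a :* (y :* z) :+ b :* (y :* w))
                refl a b (Y i k) (Z₁ k j) (Z₂ k j))) ⟩
      sum (λ k → a * (Y i k * Z₁ k j) + b * (Y i k * Z₂ k j))
        ≈⟨ ∑-distrib-+ (λ k → a * (Y i k * Z₁ k j)) (λ k → b * (Y i k * Z₂ k j)) ⟩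
      sum (λ k → a * (Y i k * Z₁ k j)) + sum (λ k → b * (Y i k * Z₂ k j))
        ≈⟨ +-cong (*-distribˡ-sum a (λ k → Y i k * Z₁ k j)) (*-distribˡ-sum b (λ k → Y i k * Z₂ k j)) ⟨
      a * (Y ⊗ Z₁) i j + b * (Y ⊗ Z₂) i j ∎

    constantDiagonals-linear : ∀ {Z Z₁ Z₂} a b → (∀ i j → Z i j ≈ a * Z₁ i j + b * Z₂ i j) →
      ConstantDiagonals Y Z₁ → ConstantDiagonals Y Z₂ → ConstantDiagonals Y Z
    constantDiagonals-linear a b eq Z₁-const Z₂-const m i j = trans (iterate-linear m a b eq i i)
      (trans (+-cong (*-congˡ (Z₁-const m i j)) (*-congˡ (Z₂-const m i j))) (sym (iterate-linear m a b eq j j)))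

    constantDiagonals-⊗ : ∀ {Z} → ConstantDiagonals Y Z → ConstantDiagonals Y (Y ⊗ Z)
    constantDiagonals-⊗ Z-const m = Z-const (suc m)

    constantDiagonals-identity : (∀ k i j → (Y ^ᴹ k) i i ≈ (Y ^ᴹ k) j j) → ConstantDiagonals Y identity
    constantDiagonals-identity walk m i j = trans (reflexive (iterate-^ m 0 i))
      (trans (walk (m ℕ.+ 0) i j) (reflexive (≡.sym (iterate-^ m 0 j))))
      where
      iterate-^ : ∀ m k i → iterate Y m (Y ^ᴹ k) i i ≡ (Y ^ᴹ (m ℕ.+ k)) i i
      iterate-^ zero    k i = ≡.refl
      iterate-^ (suc m) k i = ≡.trans (iterate-^ m (suc k) i) (≡.cong (λ l → (Y ^ᴹ l) i i) (ℕ.+-suc m k))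

  module _ {X : Matrix Carrier (n ℕ.* r)} {Y C : Matrix Carrier n} {w a₂ b₂ : Carrier}
           (cov : Covers X Y) (C-const : ConstantDiagonals Y C) (I-const : ConstantDiagonals Y identity)
           (X²≈ : ∀ x y → w * (X ⊗ X) x y ≈ C (π x) (π y) + a₂ * X x y + b₂ * identity x y) where

    -- Multiplication by `X` preserves this shape: the lift of `Z` becomes the lift of `Y ⊗ Z`
    -- because `X` covers `Y`, and the new `X ⊗ X` is reduced by `X²≈`, for which one more factor
    -- `w` is spent.
    power-decomposition : ∀ k → ∃[ Z ] ∃[ a ] ∃[ b ] ConstantDiagonals Y Z ×
      (∀ x y → w ^ k * (X ^ᴹ k) x y ≈ Z (π x) (π y) + a * X x y + b * identity x y)
    -- The zero matrix, spelled as a combination of identities so that `constantDiagonals-linear`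
    -- covers it.
    power-decomposition zero = (λ i j → 0# * identity i j + 0# * identity i j) , 0# , 1# ,
      constantDiagonals-linear 0# 0# (λ i j → refl) I-const I-const ,
      λ x y → solve 3 (λ i p x → :1 :* i := :0 :* p :+ :0 :* p :+ :0 :* x :+ :1 :* i) refl
        (identity x y) (identity (π x) (π y)) (X x y)
    power-decomposition (suc k) with power-decomposition k
    ... | Z , a , b , Z-const , Xᵏ≈ =
      (λ i j → w * (Y ⊗ Z) i j + a * C i j) , a * a₂ + w * b , a * b₂ ,
      constantDiagonals-linear w a (λ i j → refl) (constantDiagonals-⊗ Z-const) C-const ,
      λ x y → begin
        w ^ suc k * sum (λ z → X x z * (X ^ᴹ k) z y)
          ≈⟨ trans (*-assoc w _ _) (*-congˡ (*-distribˡ-sum (w ^ k) (λ z → X x z * (X ^ᴹ k) z y))) ⟩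
        w * sum (λ z → w ^ k * (X x z * (X ^ᴹ k) z y))
          ≈⟨ *-congˡ (sum-cong-≋ (λ z → trans
               (solve 3 (λ w x p → w :* (x :* p) := x :* (w :* p)) refl (w ^ k) (X x z) ((X ^ᴹ k) z y))
               (trans (*-congˡ {X x z} (Xᵏ≈ z y))
                 (solve 6 (λ x z a p b i → x :* (z :+ a :* p :+ b :* i) := x :* z :+ a :* (x :* p) :+ b :* x :* i)
                   refl (X x z) (Z (π z) (π y)) a (X z y) b (identity z y))))) ⟩
        w * sum (λ z → X x z * Z (π z) (π y) + a * (X x z * X z y) + b * X x z * identity z y)
          ≈⟨ *-congˡ (trans (∑-distrib-+ (λ z → X x z * Z (π z) (π y) + a * (X x z * X z y)) (λ z → b * X x z * identity z y))
               (+-cong (∑-distrib-+ (λ z → X x z * Z (π z) (π y)) (λ z → a * (X x z * X z y)))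
                       (sum-identityʳ y (λ z → b * X x z)))) ⟩
        w * (sum (λ z → X x z * Z (π z) (π y)) + sum (λ z → a * (X x z * X z y)) + b * X x y)
          ≈⟨ *-congˡ (+-congʳ (+-cong (covers-sum {X} {Y} cov x (λ v → Z v (π y)))
                 (sym (*-distribˡ-sum a (λ z → X x z * X z y))))) ⟩
        w * ((Y ⊗ Z) (π x) (π y) + a * (X ⊗ X) x y + b * X x y)
          ≈⟨ solve 6 (λ w p a q b x → w :* (p :+ a :* q :+ b :* x) := w :* p :+ a :* (w :* q) :+ w :* b :* x)
               refl w ((Y ⊗ Z) (π x) (π y)) a ((X ⊗ X) x y) b (X x y) ⟩
        w * (Y ⊗ Z) (π x) (π y) + a * (w * (X ⊗ X) x y) + w * b * X x y
          ≈⟨ +-congʳ (+-congˡ (*-congˡ (X²≈ x y))) ⟩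
        w * (Y ⊗ Z) (π x) (π y) + a * (C (π x) (π y) + a₂ * X x y + b₂ * identity x y) + w * b * X x y
          ≈⟨ solve 8 (λ p a c d x e i f → p :+ a :* (c :+ d :* x :+ e :* i) :+ f :* x
                        := p :+ a :* c :+ (a :* d :+ f) :* x :+ a :* e :* i)
               refl (w * (Y ⊗ Z) (π x) (π y)) a (C (π x) (π y)) a₂ (X x y) b₂ (identity x y) (w * b) ⟩
        w * (Y ⊗ Z) (π x) (π y) + a * C (π x) (π y) + (a * a₂ + w * b) * X x y + a * b₂ * identity x y ∎

    power-diagonal : w # 0# → (∀ x → X x x ≈ 0#) → ∀ k x y → (X ^ᴹ k) x x ≈ (X ^ᴹ k) y y
    power-diagonal w#0 X-diag k x y with power-decomposition k
    ... | Z , a , b , Z-const , Xᵏ≈ = cancelˡ-#0 (^-#0 k w#0) (begin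
      w ^ k * (X ^ᴹ k) x x                                   ≈⟨ Xᵏ≈ x x ⟩
      Z (π x) (π x) + a * X x x + b * identity x x
        ≈⟨ +-cong (+-cong (Z-const 0 (π x) (π y)) (*-congˡ (trans (X-diag x) (sym (X-diag y)))))
                  (*-congˡ (trans (identity-diagonal x) (sym (identity-diagonal y)))) ⟩
      Z (π y) (π y) + a * X y y + b * identity y y           ≈⟨ Xᵏ≈ y y ⟨
      w ^ k * (X ^ᴹ k) y y                                   ∎)

-- The quadratic polynomial that kills the new eigenvalues

module TwoEigenvalueCovers {c ℓ₁ ℓ₂} (ℝ : RealNumbers c ℓ₁ ℓ₂) (n r : ℕ) where
  open RealNumbers ℝ using (commutativeRing; rawSemiring)
  open CommutativeRing commutativeRing hiding (zero)
  open IntegerCoefficients commutativeRing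
  open OrderedField ℝ
  open HomogeneousSpectrum ℝ
  open QuotientMatrices ℝ n r
  open Spectrum ℝ using (IsSpectrum)
  open MatrixPower rawSemiring
  open import Algebra.Properties.Semiring.Sum semiring using (sum-cong-≋)
  open Determinants commutativeRing using (sum-identityʳ)
  open import Data.List.Base using (map)
  import Data.List.Properties as List
  open import Data.List.Relation.Unary.All as All using (All; []; _∷_)
  open import Data.List.Relation.Binary.Permutation.Setoid setoid using (_↭_)
  import Data.List.Relation.Binary.Permutation.Setoid.Properties as Permutation
  open import Relation.Binary.Reasoning.Setoid setoid

  sumOver : (Carrier → Carrier) → List Carrier → Carrier
  sumOver h = foldr (λ x p → h x + p) 0#

  sumOver-↭ : ∀ {h} → (∀ {x y} → x ≈ y → h x ≈ h y) → ∀ {σ ρ} → σ ↭ ρ → sumOver h σ ≈ sumOver h ρ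
  sumOver-↭ {h} h-cong {σ} {ρ} σ↭ρ = begin
    sumOver h σ            ≡⟨ List.foldr-map _+_ h 0# σ ⟨
    foldr _+_ 0# (map h σ) ≈⟨ Permutation.foldr-commMonoid setoid +-isCommutativeMonoid
                                (Permutation.map⁺ setoid setoid h-cong σ↭ρ) ⟩
    foldr _+_ 0# (map h ρ) ≡⟨ List.foldr-map _+_ h 0# ρ ⟩
    sumOver h ρ            ∎

  sumOver-++-zero : ∀ {h} σ {δ} → All (λ x → h x ≈ 0#) δ → sumOver h (σ ++ δ) ≈ sumOver h σ
  sumOver-++-zero []      []         = refl
  sumOver-++-zero []      (h≈0 ∷ δ₀) = trans (+-cong h≈0 (sumOver-++-zero [] δ₀)) (+-identityˡ 0#)
  sumOver-++-zero (x ∷ σ) δ₀         = +-congˡ (sumOver-++-zero σ δ₀)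

  module _ (θ τ : Carrier) where

    2# : Carrier
    2# = 1# + 1#

    2#0 : 2# # 0#
    2#0 = #-congʳ (solve 0 (:1 :+ (:1 :+ :0) := :1 :+ :1) refl) (ι-# {0} {2} (ℕ.s≤s ℕ.z≤n))

    shift : ∀ {k} → Matrix Carrier k → Matrix Carrier k
    shift M = affine 2# M (- (θ + τ))

    -- 4 (M − θ) (M − τ) as a difference of squares.
    quadratic : ∀ {k} → Matrix Carrier k → Matrix Carrier k
    quadratic M = affine 1# (shift M ⊗ shift M) (- ((θ - τ) * (θ - τ)))

    q : Carrier → Carrier
    q x = 1# * ((2# * x + - (θ + τ)) * (2# * x + - (θ + τ))) + - ((θ - τ) * (θ - τ))

    q-cong : ∀ {x y} → x ≈ y → q x ≈ q y
    q-cong x≈y = +-congʳ (*-congˡ (*-cong x≈y′ x≈y′))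
      where x≈y′ = +-congʳ (*-congˡ x≈y)

    q-root : ∀ {x} → x ≈ θ ⊎ x ≈ τ → q x ≈ 0#
    q-root (inj₁ x≈θ) = trans (q-cong x≈θ) (solve 2 (λ a b →
      :1 :* (((:1 :+ :1) :* a :+ (:- (a :+ b))) :* ((:1 :+ :1) :* a :+ (:- (a :+ b))))
        :+ (:- ((a :- b) :* (a :- b))) := :0) refl θ τ)
    q-root (inj₂ x≈τ) = trans (q-cong x≈τ) (solve 2 (λ a b →
      :1 :* (((:1 :+ :1) :* b :+ (:- (a :+ b))) :* ((:1 :+ :1) :* b :+ (:- (a :+ b))))
        :+ (:- ((a :- b) :* (a :- b))) := :0) refl θ τ)

    trace-quadratic² : ∀ {k} (M : Matrix Carrier k) σ → IsSpectrum M σ →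
                       trace (quadratic M ⊗ quadratic M) ≈ sumOver (λ x → q x * q x) σ
    trace-quadratic² M σ spec = trace-hasSpectrum (hasSpectrum-square {M = quadratic M}
      (hasSpectrum-affine 1# (- ((θ - τ) * (θ - τ))) (hasSpectrum-square
        (hasSpectrum-affine 2# (- (θ + τ)) (isSpectrum⇒hasSpectrum {M = M} {σ} spec)))))

    symmetric-quadratic : ∀ {k} {M : Matrix Carrier k} → Symmetricᴹ M → Symmetricᴹ (quadratic M)
    symmetric-quadratic {M = M} M-sym = symmetric-affine {M = shift M ⊗ shift M} _ _
      (symmetric-square {M = shift M} (symmetric-affine {M = M} _ _ M-sym))

    quadratic-expand : ∀ {k} (M : Matrix Carrier k) i j → quadratic M i j ≈
      2# * 2# * (M ⊗ M) i j + (- (2# * 2# * (θ + τ)) * M i j + (2# * 2# * (θ * τ)) * identity i j)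
    quadratic-expand M i j = trans (+-congʳ (*-congˡ (affine-⊗ 2# (- (θ + τ)) 2# (- (θ + τ)) M M i j)))
      (solve 5 (λ a b p m i → let two = :1 :+ :1 in
        :1 :* (two :* two :* p :+ two :* (:- (a :+ b)) :* m :+ (:- (a :+ b)) :* two :* m
               :+ (:- (a :+ b)) :* (:- (a :+ b)) :* i) :+ (:- ((a :- b) :* (a :- b))) :* i
        := two :* two :* p :+ ((:- (two :* two :* (a :+ b))) :* m :+ two :* two :* (a :* b) :* i))
        refl θ τ ((M ⊗ M) i j) (M i j) (identity i j))

    power-diagonal-constant : ∀ {X Y} → Covers X Y → Symmetricᴹ X → Symmetricᴹ Y → (∀ x → X x x ≈ 0#) →
      ∀ {σX σY δ} → IsSpectrum X σX → IsSpectrum Y σY → σX ↭ σY ++ δ → All (λ x → x ≈ θ ⊎ x ≈ τ) δ →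
      (∀ k i j → (Y ^ᴹ k) i i ≈ (Y ^ᴹ k) j j) → ∀ k x y → (X ^ᴹ k) x x ≈ (X ^ᴹ k) y y
    power-diagonal-constant {X} {Y} cov X-sym Y-sym X-diag {σX} {σY} {δ} specX specY split twoEv walk k x y =
      -- `w` is `r`, from the rigidity, times the leading coefficient 4 of the quadratic. The fibre
      -- coordinate of `x` lies in `Fin r`, so `r` is positive.
      power-diagonal {C = quadratic Y} {w = ι r * (2# * 2#)} cov quadratic-const I-const X²≈
        (x#0y#0→xy#0 (ι-# (0<Fin (remainder {n} r x))) (x#0y#0→xy#0 2#0 2#0)) X-diag k x y
      where
      0<Fin : ∀ {m} → Fin m → 0 ℕ.< m
      0<Fin {suc m} _ = ℕ.s≤s ℕ.z≤n

      traces : trace (quadratic X ⊗ quadratic X) ≈ trace (quadratic Y ⊗ quadratic Y)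
      traces = begin
        trace (quadratic X ⊗ quadratic X)         ≈⟨ trace-quadratic² X σX specX ⟩
        sumOver (λ x → q x * q x) σX              ≈⟨ sumOver-↭ (λ x≈y → *-cong (q-cong x≈y) (q-cong x≈y)) split ⟩
        sumOver (λ x → q x * q x) (σY ++ δ)       ≈⟨ sumOver-++-zero σY
                                                     (All.map (λ x≈ → trans (*-congʳ (q-root x≈)) (zeroˡ _)) twoEv) ⟩
        sumOver (λ x → q x * q x) σY              ≈⟨ trace-quadratic² Y σY specY ⟨
        trace (quadratic Y ⊗ quadratic Y)         ∎

      rigid : ∀ x y → ι r * quadratic X x y ≈ quadratic Y (π x) (π y)
      rigid = covers-rigid {quadratic X} {quadratic Y} (symmetric-quadratic X-sym) (symmetric-quadratic Y-sym)
        (covers-affine {shift X ⊗ shift X} {shift Y ⊗ shift Y} _ _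
          (covers-⊗ {shift X} {shift X} {shift Y} {shift Y}
            (covers-affine {X} {Y} _ _ cov) (covers-affine {X} {Y} _ _ cov))) traces

      X²≈ : ∀ x y → ι r * (2# * 2#) * (X ⊗ X) x y ≈ quadratic Y (π x) (π y)
              + ι r * (2# * 2# * (θ + τ)) * X x y + - (ι r * (2# * 2# * (θ * τ))) * identity x y
      X²≈ x y = trans
        (solve 7 (λ ρ w p a m b i → ρ :* w :* p
            := ρ :* (w :* p :+ ((:- a) :* m :+ b :* i)) :+ ρ :* a :* m :+ (:- (ρ :* b)) :* i)
          refl (ι r) (2# * 2#) ((X ⊗ X) x y) (2# * 2# * (θ + τ)) (X x y) (2# * 2# * (θ * τ)) (identity x y))
        (+-congʳ (+-congʳ (trans (*-congˡ (sym (quadratic-expand X x y))) (rigid x y))))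

      I-const : ConstantDiagonals Y identity
      I-const = constantDiagonals-identity {Y} walk

      Y-const : ConstantDiagonals Y (Y ⊗ identity)
      Y-const = constantDiagonals-⊗ {Y} {identity} I-const

      quadratic-const : ConstantDiagonals Y (quadratic Y)
      -- `Y` and its square are rewritten as products ending in `identity`, the form in which
      -- `constantDiagonals-⊗` reaches them.
      quadratic-const = constantDiagonals-linear {Y} {Z₁ = Y ⊗ (Y ⊗ identity)} {Z₂ = linear} (2# * 2#) 1#
        (λ i j → trans (quadratic-expand Y i j) (+-cong
          (*-congˡ (sum-cong-≋ (λ l → *-congˡ {Y i l} (sym (sum-identityʳ j (Y l)))))) (sym (*-identityˡ _))))
        (constantDiagonals-⊗ {Y} {Y ⊗ identity} Y-const)
        (constantDiagonals-linear {Y} {Z₁ = Y ⊗ identity} {Z₂ = identity} _ _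
          (λ i j → +-congʳ (*-congˡ (sym (sum-identityʳ j (Y i))))) Y-const I-const)
        where
        linear : Matrix Carrier n
        linear i j = - (2# * 2# * (θ + τ)) * Y i j + (2# * 2# * (θ * τ)) * identity i j

-- Adjacency matrices over ℕ and ℝ, and the covering relation between them

module AdjacencyMatrices {c ℓ₁ ℓ₂} (ℝ : RealNumbers c ℓ₁ ℓ₂) where
  open RealNumbers ℝ using (commutativeRing; rawSemiring)
  open CommutativeRing commutativeRing hiding (zero)
  open Determinants commutativeRing using (sum-zero; sum-identityˡ; identity-diagonal)
  open OrderedField ℝ
  open QuotientMatrices ℝ using (Covers)
  open MatrixPower rawSemiring
  private module ℕᴹ = MatrixPower ℕ.+-*-rawSemiring
  open import Algebra.Definitions.RawSemiring ℕ.+-*-rawSemiring using () renaming (sum to sumℕ)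
  open import Algebra.Properties.Semiring.Sum semiring using (sum; sum-cong-≋)
  open import Relation.Binary.Reasoning.Setoid setoid

  ι-indicator : ∀ b → ι (if b then 1 else 0) ≈ (if b then 1# else 0#)
  ι-indicator true  = +-identityʳ 1#
  ι-indicator false = refl

  ι-sum : ∀ {n} (f : Fin n → ℕ) → ι (sumℕ f) ≈ sum (ι ∘ f)
  ι-sum {zero}  f = refl
  ι-sum {suc n} f = trans (ι-+ (f zero) (sumℕ (f ∘ suc))) (+-congˡ (ι-sum (f ∘ suc)))

  ι-^ᴹ : ∀ {n} {M : Matrix ℕ n} {N : Matrix Carrier n} → (∀ i j → ι (M i j) ≈ N i j) →
         ∀ k i j → ι ((M ℕᴹ.^ᴹ k) i j) ≈ (N ^ᴹ k) i j
  ι-^ᴹ         M≈N zero    i j = ι-indicator (does (i Fin.≟ j))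
  ι-^ᴹ {M = M} M≈N (suc k) i j = trans (ι-sum (λ l → M i l ℕ.* (M ℕᴹ.^ᴹ k) l j))
    (sum-cong-≋ (λ l → trans (ι-* (M i l) ((M ℕᴹ.^ᴹ k) l j)) (*-cong (M≈N i l) (ι-^ᴹ M≈N k l j))))

  module _ {V : Set} {n : ℕ} (enum : Fin n ↔ V) (Y : Graph V) where
    open Graph Y

    A : Matrix Carrier n
    A = adjacencyMatrix rawSemiring enum Y

    A-symmetric : ∀ i j → A i j ≈ A j i
    A-symmetric i j = reflexive (≡.cong (if_then 1# else 0#)
      (does-⇔ (mk⇔ symm symm) (adj? (Inverse.to enum i) (Inverse.to enum j)) (adj? (Inverse.to enum j) (Inverse.to enum i))))

    A-diagonal : ∀ i → A i i ≈ 0#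
    A-diagonal i = reflexive (≡.cong (if_then 1# else 0#)
      (dec-false (adj? (Inverse.to enum i) (Inverse.to enum i)) (irrefl ≡.refl)))

    A-power : ∀ k i j → ι ((adjacencyMatrix ℕ.+-*-rawSemiring enum Y ℕᴹ.^ᴹ k) i j) ≈ (A ^ᴹ k) i j
    A-power = ι-^ᴹ (λ i j → ι-indicator (does (adj? (Inverse.to enum i) (Inverse.to enum j))))

    walkRegular⇒constant : WalkRegular enum Y → ∀ k i j → (A ^ᴹ k) i i ≈ (A ^ᴹ k) j j
    -- `WalkRegular` starts at the first power, whereas the span of powers used above includes the
    -- identity.
    walkRegular⇒constant walk zero    i j = trans (identity-diagonal i) (sym (identity-diagonal j))
    walkRegular⇒constant walk (suc k) i j = begin
      (A ^ᴹ suc k) i i    ≈⟨ A-power (suc k) i i ⟨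
      _                   ≡⟨ ≡.cong ι (walk (suc k) (ℕ.s≤s ℕ.z≤n) i j) ⟩
      _                   ≈⟨ A-power (suc k) j j ⟩
      (A ^ᴹ suc k) j j    ∎

    -- Walk counts are natural numbers, and an ordered field has characteristic zero, so `ι`
    -- reflects their equality.
    constant⇒walkRegular : (∀ k i j → (A ^ᴹ k) i i ≈ (A ^ᴹ k) j j) → WalkRegular enum Y
    constant⇒walkRegular const k _ i j = ι-injective (trans (A-power k i i) (trans (const k i j) (sym (A-power k j j))))

    module _ {r : ℕ} {G : Pred (Permutation′ r) 0ℓ} (f : SymmetricArcFunction Y G) where
      open SymmetricArcFunction f using (value; zero⇔)

      -- A vertex `(v , i)` has exactly one neighbour over each neighbour `u` of `v`, at the image
      -- of `i` under the permutation `value u v`, and none over any other vertex.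
      cover-covers : Covers n r (adjacencyMatrix rawSemiring (coverEnum enum r) (cover f)) A
      cover-covers x u = trans
        (sum-cong-≋ (λ j → reflexive (≡.cong
            (λ y → if does (Graph.adj? (cover f) (vertex (remQuot r x)) (vertex y)) then 1# else 0#)
          (Fin.remQuot-combine u j))))
        (fibre-sum (proj₁ (remQuot {n} r x)) (proj₂ (remQuot {n} r x)) u)
        where
        vertex : Fin n × Fin r → V × Fin r
        vertex (v , j) = Inverse.to enum v , j
        fibre-sum : ∀ v i u →
                    sum (λ j → if does (Graph.adj? (cover f) (vertex (v , i)) (vertex (u , j))) then 1# else 0#) ≈ A v u
        fibre-sum v i u with adj? (Inverse.to enum v) (Inverse.to enum u)
        ... | no  _ = sum-zero {r} (λ _ → 0#) (λ _ → refl)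
        ... | yes v~u with value (Inverse.to enum u) (Inverse.to enum v) in eq
        ...   | nothing = ⊥-elim (Equivalence.to (zero⇔ _ _) eq (symm v~u))
        -- The adjacency test of the cover computes here to row `g ⟨$⟩ʳ i` of the identity matrix,
        -- whose entries sum to `1#`.
        ...   | just g  = trans (sum-cong-≋ (λ j → sym (*-identityʳ (identity (g ⟨$⟩ʳ i) j))))
            (sum-identityˡ (g ⟨$⟩ʳ i) (λ _ → 1#))

theorem5p1 : ∀ {c ℓ₁ ℓ₂} (ℝ : RealNumbers c ℓ₁ ℓ₂)
    {V : Set} {n r : ℕ} (enum : Fin n ↔ V) (Y : Graph V) → Connected Y →
    (G : Pred (Permutation′ r) 0ℓ) → IsPermutationGroup G →
    (f : SymmetricArcFunction Y G) →
    Normalized f → ActsRegularly ⟨ Values f ⟩ →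
    WalkRegular enum Y →
    IsCyclic ⟨ Values f ⟩ → Is2evCover ℝ enum Y f →
    WalkRegular (coverEnum enum r) (cover f)
theorem5p1 ℝ {n = n} {r} enum Y _ _ _ f _ _ walk _
  record { specY = specY ; specX = specX ; split = split ; twoEv = θ , τ , _ , _ , _ , θ-or-τ } =
  constant⇒walkRegular (coverEnum enum r) (cover f)
    (power-diagonal-constant θ τ (cover-covers enum Y f) (A-symmetric (coverEnum enum r) (cover f)) (A-symmetric enum Y)
      (A-diagonal (coverEnum enum r) (cover f)) specX specY split θ-or-τ (walkRegular⇒constant enum Y walk))
  where
  open AdjacencyMatrices ℝ
  open TwoEigenvalueCovers ℝ n r
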